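{- Let $m\ge 1$ and $n = 2m+1$. Given a universal cycle of the maximum ordered matchings of $K_n$ (i.e. of $\mathcal{M}_m(K_n)$), a $2$-by-$\frac{n!}{2}$ shorthand universal torus for the permutations of $\{0,\ldots,n-1\}$, with $2$-by-$m$ windows, can be generated in amortized $\mathcal{O}(1)$-time per column using additional space polynomial in $n$.
   Context: $K_n$ is the complete graph on $\{0,\ldots,n-1\}$. An ordered matching of size $m$ in $K_n$ is an ordered list $[e_1,\ldots,e_m]$ of $m$ pairwise vertex-disjoint edges; $\mathcal{M}_m(K_n)$ is the set of all of these, and $|\mathcal{M}_m(K_n)| = \frac{n!}{2^m}$. A universal cycle of $\mathcal{M}_m(K_n)$ is a cyclic sequence of edges of length $|\mathcal{M}_m(K_n)|$ in which every ordered matching in $\mathcal{M}_m(K_n)$ occurs exactly once as $m$ cyclically consecutive terms. A $2$-by-$\frac{n!}{2}$ shorthand universal torus for the permutations of $[n]=\{0,\ldots,n-1\}$ with $2$-by-$m$ windows is an array $T:\mathbb{Z}_2\times\mathbb{Z}_{n!/2}\to[n]$ such that every word of length $n-1=2m$ with pairwise distinct entries in $[n]$ equals the row-major reading $T(i,j)\cdots T(i,j+m-1)\,T(i+1,j)\cdots T(i+1,j+m-1)$ for exactly one position $(i,j)$ (indices modulo $2$ and $n!/2$). Generating the torus means outputting its columns one after another from left to right. Amortized $\mathcal{O}(1)$-time per column means the total running time is $\mathcal{O}(1)$ times the number $\frac{n!}{2}$ of columns, in the unit-cost RAM model. The universal cycle is given as input; additional space means working space excluding the storage of the input and output. -}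

module Defs where

open import Data.Fin.Base as Fin using (Fin; toℕ)
open import Data.Fin.Properties using (nonZeroIndex)
open import Data.List.Base using (List; []; _∷_; map; head; drop; reverse; concatMap; allFin)
open import Data.Maybe.Base using (Maybe; just; nothing; fromMaybe)
open import Data.Nat.Base using (ℕ; zero; suc; _+_; _*_; _∸_; _^_; _/_; _!; _≤_)
open import Data.Nat.DivMod using (_mod_)
open import Data.Nat.ListAction using (sum)
open import Data.Nat.Logarithm using (⌈log₂_⌉)
open import Data.Nat.Properties using (m^n≢0)
open import Data.Product using (_×_; _,_; ∃!)
open import Data.Sum.Base using (_⊎_)
open import Data.Vec.Base using (Vec; _++_; tabulate)
open import Data.Vec.Relation.Unary.AllPairs using (AllPairs)
open import Data.Vec.Relation.Unary.Unique.Propositional using (Unique)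
open import Relation.Binary.PropositionalEquality using (_≡_)
open import Relation.Nullary.Negation using (¬_)

-- Cyclic indices: i ⊕ k is i + k in ℤ_N.

infixl 6 _⊕_

_⊕_ : ∀ {N} → Fin N → ℕ → Fin N
_⊕_ {N} i k = _mod_ (toℕ i + k) N {{nonZeroIndex i}}

------------------------------------------------------------------------
-- Ordered matchings and their universal cycles

-- An edge of K_n is an unordered pair of distinct vertices; listing the
-- smaller endpoint first makes _≡_ the equality of edges.

record Edge (n : ℕ) : Set where
  constructor edge
  field
    lo hi  : Fin n
    .lo<hi : lo Fin.< hi

open Edge public

_∈ᵉ_ : ∀ {n} → Fin n → Edge n → Set
v ∈ᵉ e = v ≡ lo e ⊎ v ≡ hi e

VertexDisjoint : ∀ {n} → Edge n → Edge n → Set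
VertexDisjoint e f = ∀ v → v ∈ᵉ e → ¬ (v ∈ᵉ f)

IsOrderedMatching : ∀ {n m} → Vec (Edge n) m → Set
IsOrderedMatching = AllPairs VertexDisjoint

-- n! / 2^m, the number of ordered matchings of size m in K_n when
-- n = 2m + 1 (in general it would be n! / (2^m (n − 2m)!)).

#matchings : ℕ → ℕ → ℕ
#matchings n m = _/_ (n !) (2 ^ m) {{m^n≢0 2 m}}

cyclicWindow : ∀ {A : Set} {N} (m : ℕ) → (Fin N → A) → Fin N → Vec A m
cyclicWindow m C i = tabulate λ k → C (i ⊕ toℕ k)

IsUniversalCycle : (n m : ℕ) → (Fin (#matchings n m) → Edge n) → Set
IsUniversalCycle n m C =
  (M : Vec (Edge n) m) → IsOrderedMatching M →
  ∃! _≡_ λ i → cyclicWindow m C i ≡ M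

------------------------------------------------------------------------
-- Shorthand universal tori with two rows

Array : ℕ → ℕ → Set
Array n N = Fin 2 → Fin N → Fin n

rowMajor : ∀ {n N} (m : ℕ) → Array n N → Fin 2 → Fin N → Vec (Fin n) (m + m)
rowMajor m T i j = cyclicWindow m (T i) j ++ cyclicWindow m (T (i ⊕ 1)) j

-- Meant for n = 2m + 1, where the words have length m + m = n - 1.

IsShorthandUniversalTorus : (n m : ℕ) → Array n (n ! / 2) → Set
IsShorthandUniversalTorus n m T =
  (w : Vec (Fin n) (m + m)) → Unique w →
  ∃! {A = Fin 2 × Fin (n ! / 2)} _≡_ λ (i , j) → rowMajor m T i j ≡ w

------------------------------------------------------------------------
-- Unit-cost RAM with a read-only, randomly accessible input and a
-- write-only output.  X is the working memory, a sequence of natural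
-- numbers; each executed instruction costs one time unit.

data Instr : Set where
  const : (i c : ℕ) → Instr      -- X[i] ← c
  add   : (i j k : ℕ) → Instr    -- X[i] ← X[j] + X[k]
  sub   : (i j k : ℕ) → Instr    -- X[i] ← X[j] ∸ X[k]
  load  : (i j : ℕ) → Instr      -- X[i] ← X[X[j]]
  store : (i j : ℕ) → Instr      -- X[X[i]] ← X[j]
  read  : (i j : ℕ) → Instr      -- X[i] ← Input[X[j]]
  write : (i : ℕ) → Instr        -- append X[i] to the output
  jump  : (l : ℕ) → Instr        -- go to instruction l
  jzero : (i l : ℕ) → Instr      -- if X[i] = 0, go to instruction l

Program : Set
Program = List Instr

-- The memory is the list of the cells up to the largest address written
-- so far; all cells beyond it hold 0.

Memory : Set
Memory = List ℕ

-- Out of range, the value is 0.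
get : List ℕ → ℕ → ℕ
get xs a = fromMaybe 0 (head (drop a xs))

set : Memory → ℕ → ℕ → Memory
set []       zero    v = v ∷ []
set []       (suc a) v = 0 ∷ set [] a v
set (x ∷ xs) zero    v = v ∷ xs
set (x ∷ xs) (suc a) v = x ∷ set xs a v

record Config : Set where
  constructor config
  field
    pc  : ℕ
    mem : Memory
    out : List ℕ    -- most recent word first

open Config public

initial : Config
initial = config 0 [] []

exec : List ℕ → Instr → Config → Config
exec inp (const i c) (config p X o) = config (suc p) (set X i c) o
exec inp (add i j k) (config p X o) = config (suc p) (set X i (get X j + get X k)) o
exec inp (sub i j k) (config p X o) = config (suc p) (set X i (get X j ∸ get X k)) o
exec inp (load i j)  (config p X o) = config (suc p) (set X i (get X (get X j))) o
exec inp (store i j) (config p X o) = config (suc p) (set X (get X i) (get X j)) o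
exec inp (read i j)  (config p X o) = config (suc p) (set X i (get inp (get X j))) o
exec inp (write i)   (config p X o) = config (suc p) X (get X i ∷ o)
exec inp (jump l)    (config p X o) = config l X o
exec inp (jzero i l) (config p X o) with get X i
... | zero  = config l X o
... | suc _ = config (suc p) X o

fetch : Program → Config → Maybe Instr
fetch P s = head (drop (pc s) P)

-- Working space in bits.  ⌈log₂ (x + 1)⌉ is the binary length of x; the
-- extra bit makes cells holding 0 count too.  Counting bits rather than
-- cells keeps the unit-cost arithmetic from being exploited through huge
-- numbers.

space : Config → ℕ
space s = sum (map (λ x → suc ⌈log₂ suc x ⌉) (mem s))

-- Run P inp b s t s′: from s, the program halts in s′ after exactly t
-- instructions, never using more than b bits of working space.  It halts
-- when the program counter leaves the program.

data Run (P : Program) (inp : List ℕ) (b : ℕ) : Config → ℕ → Config → Set where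
  halt : ∀ {s} → space s ≤ b → fetch P s ≡ nothing → Run P inp b s 0 s
  next : ∀ {s I t s′} → space s ≤ b → fetch P s ≡ just I →
         Run P inp b (exec inp I s) t s′ → Run P inp b s (suc t) s′

record Outputs (P : Program) (inp outp : List ℕ) (time bits : ℕ) : Set where
  field
    final   : Config
    steps   : ℕ
    steps≤  : steps ≤ time
    run     : Run P inp bits initial steps final
    output  : reverse (out final) ≡ outp

------------------------------------------------------------------------
-- Encodings

encodeCycle : ∀ {n L} → (Fin L → Edge n) → List ℕ
encodeCycle {n} {L} C =
  n ∷ L ∷ concatMap (λ i → toℕ (lo (C i)) ∷ toℕ (hi (C i)) ∷ []) (allFin L)

-- The columns from left to right, each as its upper entry followed by its
-- lower entry.

encodeColumns : ∀ {n N} → Array n N → List ℕ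
encodeColumns {N = N} T =
  concatMap (λ j → toℕ (T Fin.zero j) ∷ toℕ (T (Fin.suc Fin.zero) j) ∷ []) (allFin N)

{-# OPTIONS --safe #-}
module Submission where

-- Traverse the universal cycle 2^(m-1) times, so that every ordered matching
-- is read once in each pass, and orient its edges by a counter: in pass x,
-- the edge at position p is flipped if bit p mod m, from the most significant
-- one, of the m-bit word of x is 1.  As m divides n!/2^m, passes start aligned
-- with the word.  The flips in a window at a given position are then, up to
-- rotation, the word of x with some of its initial bits replaced by those of
-- x + 1.  This determines x, as the carry into these initial bits depends on
-- the other bits only, and every word with leading bit 0 arises.  The leading
-- bit is 0 for all x < 2^(m-1), so it tells in which row the window starts.

open import Defs
open import Data.Bool.Base using (Bool; true; false; not; _∧_; _xor_; T)
open import Data.Bool.Properties using (xor-identityʳ)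
open import Data.Fin.Base as Fin using (Fin; toℕ; fromℕ<; _↑ˡ_; _↑ʳ_)
open import Data.Fin.Properties as Fin using (toℕ<n; toℕ-fromℕ<; fromℕ<-cong; toℕ-injective; nonZeroIndex)
open import Data.List.Base as List
  using (List; []; _∷_; _∷ʳ_; length; map; reverse; concatMap; allFin; upTo; applyUpTo)
open import Data.List.Properties
  using (upTo-∷ʳ; concatMap-++; concatMap-map; map-tabulate; unfold-reverse; ++-assoc)
open import Data.List.Relation.Unary.All using (All; []; _∷_)
open import Data.List.Relation.Unary.All.Properties as All using ()
open import Data.Maybe.Base using (just; nothing)
open import Data.Nat.Base
open import Data.Nat.Divisibility
  using (_∣_; divides; ∣⇒≤; ∣-trans; n∣m*n; n∣n; m∣m*n; ∣n⇒∣m*n; ∣m+n∣m⇒∣n)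
open import Data.Nat.DivMod
open import Data.Nat.ListAction using (sum)
open import Data.Nat.Logarithm using (⌈log₂_⌉; ⌈log₂⌉-mono-≤; ⌈log₂2^n⌉≡n)
open import Data.Nat.Properties
open import Data.Nat.Tactic.RingSolver using (solve-∀)
open import Data.Product using (Σ-syntax; ∃!; _×_; _,_; proj₁; proj₂)
open import Data.Sum.Base using (_⊎_; inj₁; inj₂)
open import Data.Unit.Base using (⊤)
open import Data.Vec.Base using (Vec; []; _∷_; lookup; tabulate; replicate)
open import Data.Vec.Properties using (lookup-++ˡ; lookup-++ʳ; lookup∘tabulate; tabulate∘lookup; tabulate-cong)
open import Data.Vec.Relation.Unary.AllPairs.Properties as AllPairs using ()
open import Data.Vec.Relation.Unary.Unique.Propositional using (Unique)
open import Data.Vec.Relation.Unary.Unique.Propositional.Properties using (lookup-injective)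
open import Function.Base using (_∘_; id)
open import Relation.Binary.Definitions using (tri<; tri≈; tri>)
open import Relation.Binary.PropositionalEquality
open import Relation.Nullary using (yes; no)
open import Relation.Nullary.Negation.Core using (contradiction; contradiction-irr)

-- The rows of a column are the two ends of one edge, so moving a window to the other row
-- complements all its flips. Hence at each position of the cycle only `2^(m-1)` patterns, one from
-- each complementary pair, have to occur, one per pass, and `2^(m-1)` passes have exactly `n!/2`
-- columns. The obstacle is a window that crosses the end of a pass and mixes two words. After the
-- last pass the counter wraps to 0, so even there the second word is the successor of the first
-- one. The machine can neither divide nor access single bits. It keeps the word as one number and
-- rotates it by one place per column, with additions, a comparison and a subtraction; with the most
-- significant bit first, the needed bit is the one that the comparison reveals. A pass rotates by a
-- multiple of `m` places, so one more addition gives the next word. Only computing `2^m` beforehand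
-- takes more than constant time, whence the amortization. Eleven cells hold numbers of at most
-- `4 + 2 n!`, which have `O(n^2)` bits.

-- Lengths of the cycle and of the torus

-- (2m+1)! / 2^m in the form (2m+1)!! · m!, which shows that m divides it.
cycleLength : ℕ → ℕ
cycleLength zero    = 1
cycleLength (suc m) = suc m * ((3 + m * 2) * cycleLength m)

factorial≡ : ∀ m → suc (m * 2) ! ≡ 2 ^ m * cycleLength m
factorial≡ zero    = refl
factorial≡ (suc m) = begin
  (3 + m * 2) * ((2 + m * 2) * suc (m * 2) !)              ≡⟨ cong (λ f → (3 + m * 2) * ((2 + m * 2) * f)) (factorial≡ m) ⟩
  (3 + m * 2) * ((2 + m * 2) * (2 ^ m * cycleLength m))    ≡⟨ regroup m (2 ^ m) (cycleLength m) ⟩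
  2 ^ suc m * cycleLength (suc m)                          ∎
  where
  open ≡-Reasoning
  regroup : ∀ m p f → (3 + m * 2) * ((2 + m * 2) * (p * f)) ≡ 2 * p * (suc m * ((3 + m * 2) * f))
  regroup = solve-∀

cycleLength≢0 : ∀ m → NonZero (cycleLength m)
cycleLength≢0 zero    = _
cycleLength≢0 (suc m) = m*n≢0 (suc m) ((3 + m * 2) * cycleLength m)
  {{_}} {{m*n≢0 (3 + m * 2) (cycleLength m) {{_}} {{cycleLength≢0 m}}}}

#matchings≡ : ∀ m → #matchings (suc (m * 2)) m ≡ cycleLength m
#matchings≡ m = begin
  #matchings (suc (m * 2)) m        ≡⟨ cong (_/ 2 ^ m) (trans (factorial≡ m) (*-comm (2 ^ m) _)) ⟩
  cycleLength m * 2 ^ m / 2 ^ m     ≡⟨ m*n/n≡m (cycleLength m) (2 ^ m) ⟩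
  cycleLength m                     ∎
  where
  open ≡-Reasoning
  instance _ = m^n≢0 2 m

-- Of the `m = suc k` factors 2 that the cycle length lacks, halving removes one; the others give
-- the number of passes.
half-factorial≡ : ∀ k → suc (suc k * 2) ! / 2 ≡ 2 ^ k * cycleLength (suc k)
half-factorial≡ k = begin
  suc (suc k * 2) ! / 2                          ≡⟨ cong (_/ 2) (trans (factorial≡ (suc k)) (regroup (2 ^ k) (cycleLength (suc k)))) ⟩
  2 ^ k * cycleLength (suc k) * 2 / 2            ≡⟨ m*n/n≡m (2 ^ k * cycleLength (suc k)) 2 ⟩
  2 ^ k * cycleLength (suc k)                    ∎
  where
  open ≡-Reasoning
  regroup : ∀ p f → 2 * p * f ≡ p * f * 2
  regroup = solve-∀

-- Binary counters, most significant bit first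

bit : Bool → ℕ
bit false = 0
bit true  = 1

value : ∀ {k} → Vec Bool k → ℕ
value []              = 0
value {suc k} (b ∷ v) = bit b * 2 ^ k + value v

-- The carry that an increment sends into the bit in front. The empty vector passes on the unit that
-- is added.
carry : ∀ {k} → Vec Bool k → Bool
carry []      = true
carry (b ∷ v) = b ∧ carry v

inc : ∀ {k} → Vec Bool k → Vec Bool k
inc []      = []
inc (b ∷ v) = (carry v xor b) ∷ inc v

count : ∀ k → ℕ → Vec Bool k
count k zero    = replicate k false
count k (suc x) = inc (count k x)

value<2^k : ∀ {k} (v : Vec Bool k) → value v < 2 ^ k
value<2^k []                  = s≤s z≤n
value<2^k {suc k} (false ∷ v) = ≤-trans (value<2^k v) (m≤m+n (2 ^ k) _)
value<2^k {suc k} (true ∷ v)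
  rewrite +-identityʳ (2 ^ k) = +-monoʳ-< (2 ^ k) (value<2^k v)

value-injective : ∀ {k} (u v : Vec Bool k) → value u ≡ value v → u ≡ v
value-injective []          []          eq = refl
value-injective (false ∷ u) (false ∷ v) eq = cong (false ∷_) (value-injective u v eq)
value-injective {suc k} (true ∷ u) (true ∷ v) eq =
  cong (true ∷_) (value-injective u v (+-cancelˡ-≡ (1 * 2 ^ k) _ _ eq))
value-injective {suc k} (false ∷ u) (true ∷ v) eq =
  contradiction (subst (2 ^ k ≤_) (sym eq) (≤-trans (m≤m+n (2 ^ k) 0) (m≤m+n (1 * 2 ^ k) _)))
                (<⇒≱ (value<2^k u))
value-injective {suc k} (true ∷ u) (false ∷ v) eq =
  contradiction (subst (2 ^ k ≤_) eq (≤-trans (m≤m+n (2 ^ k) 0) (m≤m+n (1 * 2 ^ k) _)))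
                (<⇒≱ (value<2^k v))

value-zeros : ∀ k → value (replicate k false) ≡ 0
value-zeros zero    = refl
value-zeros (suc k) = value-zeros k

-- Each bit acts as a half-adder. Keeping the overflow on the left lets the induction include full
-- counters.
value-inc : ∀ {k} (v : Vec Bool k) → bit (carry v) * 2 ^ k + value (inc v) ≡ suc (value v)
value-inc []              = refl
value-inc {suc k} (b ∷ v) = begin
  bit (b ∧ carry v) * (2 * 2 ^ k) + (bit (carry v xor b) * 2 ^ k + value (inc v))
    ≡⟨ regroup (bit (b ∧ carry v)) (bit (carry v xor b)) (2 ^ k) (value (inc v)) ⟩
  (bit (b ∧ carry v) * 2 + bit (carry v xor b)) * 2 ^ k + value (inc v)
    ≡⟨ cong (λ c → c * 2 ^ k + value (inc v)) (half-adder b (carry v)) ⟩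
  (bit b + bit (carry v)) * 2 ^ k + value (inc v)
    ≡⟨ regroup′ (bit b) (bit (carry v)) (2 ^ k) (value (inc v)) ⟩
  bit b * 2 ^ k + (bit (carry v) * 2 ^ k + value (inc v))
    ≡⟨ cong (bit b * 2 ^ k +_) (value-inc v) ⟩
  bit b * 2 ^ k + suc (value v)
    ≡⟨ +-suc _ _ ⟩
  suc (bit b * 2 ^ k + value v) ∎
  where
  open ≡-Reasoning
  half-adder : ∀ b c → bit (b ∧ c) * 2 + bit (c xor b) ≡ bit b + bit c
  half-adder false false = refl
  half-adder false true  = refl
  half-adder true  false = refl
  half-adder true  true  = refl
  regroup : ∀ c d p v → c * (2 * p) + (d * p + v) ≡ (c * 2 + d) * p + v
  regroup = solve-∀
  regroup′ : ∀ b c p v → (b + c) * p + v ≡ b * p + (c * p + v)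
  regroup′ = solve-∀

value-count : ∀ k x → x < 2 ^ k → value (count k x) ≡ x
value-count k zero    _     = value-zeros k
value-count k (suc x) 1+x<2^k = no-overflow (carry (count k x)) (value-inc (count k x))
  where
  no-overflow : ∀ c → bit c * 2 ^ k + value (inc (count k x)) ≡ suc (value (count k x)) →
                value (inc (count k x)) ≡ suc x
  no-overflow false eq = trans eq (cong suc (value-count k x (<⇒≤ 1+x<2^k)))
  no-overflow true  eq = contradiction
    (≤-trans (m≤m+n (2 ^ k) 0) (≤-trans (m≤m+n (1 * 2 ^ k) _)
      (≤-reflexive (trans eq (cong suc (value-count k x (<⇒≤ 1+x<2^k)))))))
    (<⇒≱ 1+x<2^k)

count-value : ∀ {k} (v : Vec Bool k) → count k (value v) ≡ v
count-value v = value-injective _ v (value-count _ (value v) (value<2^k v))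

count-wraps : ∀ k → count k (2 ^ k) ≡ count k 0
count-wraps k = value-injective _ _ (trans (overflow (carry last) (value-inc last)) (sym (value-zeros k)))
  where
  instance _ = m^n≢0 2 k
  last : Vec Bool k
  last = count k (pred (2 ^ k))
  last-value : suc (value last) ≡ 2 ^ k
  last-value = trans (cong suc (value-count k _ (≤-reflexive (suc-pred (2 ^ k))))) (suc-pred (2 ^ k))
  overflow : ∀ c → bit c * 2 ^ k + value (inc last) ≡ suc (value last) → value (count k (2 ^ k)) ≡ 0
  overflow true  eq = trans (cong (value ∘ count k) (sym (suc-pred (2 ^ k))))
    (+-cancelˡ-≡ (2 ^ k) _ 0 (trans (cong (_+ value (inc last)) (sym (*-identityˡ (2 ^ k))))
      (trans eq (trans last-value (sym (+-identityʳ (2 ^ k)))))))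
  overflow false eq = contradiction (trans eq last-value) (<⇒≢ (value<2^k (inc last)))

-- A window that runs past the last column sees pass 0 in place of pass `2 ^ k`; periodicity gives
-- both the same word.
count-periodic : ∀ k x c → count k (x + c * 2 ^ k) ≡ count k x
count-periodic k (suc x) c       = cong inc (count-periodic k x c)
count-periodic k zero    zero    = refl
count-periodic k zero    (suc c) = begin
  count k (2 ^ k + c * 2 ^ k) ≡⟨ shift (2 ^ k) ⟩
  count′ (c * 2 ^ k)          ≡⟨ lemma (c * 2 ^ k) ⟩
  count k (c * 2 ^ k)         ≡⟨ count-periodic k zero c ⟩
  count k 0                   ∎
  where
  open ≡-Reasoning
  count′ : ℕ → Vec Bool k
  count′ y = count k (y + 2 ^ k)
  shift : ∀ p → count k (p + c * 2 ^ k) ≡ count k (c * 2 ^ k + p)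
  shift p = cong (count k) (+-comm p _)
  lemma : ∀ y → count′ y ≡ count k y
  lemma zero    = count-wraps k
  lemma (suc y) = cong inc (lemma y)

-- Mixtures of a counter and its successor

blend : ∀ {k} → ℕ → Vec Bool k → Vec Bool k → Vec Bool k
blend zero    v′        v       = v
blend (suc r) []        []      = []
blend (suc r) (b′ ∷ v′) (b ∷ v) = b′ ∷ blend r v′ v

lookup-blend-< : ∀ {k} r (v′ v : Vec Bool k) s → toℕ s < r → lookup (blend r v′ v) s ≡ lookup v′ s
lookup-blend-< (suc r) (b′ ∷ v′) (b ∷ v) Fin.zero    _         = refl
lookup-blend-< (suc r) (b′ ∷ v′) (b ∷ v) (Fin.suc s) (s≤s s<r) = lookup-blend-< r v′ v s s<r

lookup-blend-≥ : ∀ {k} r (v′ v : Vec Bool k) s → r ≤ toℕ s → lookup (blend r v′ v) s ≡ lookup v s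
lookup-blend-≥ zero    v′        v       s           _         = refl
lookup-blend-≥ (suc r) (b′ ∷ v′) (b ∷ v) (Fin.suc s) (s≤s r≤s) = lookup-blend-≥ r v′ v s r≤s

xor-involutive : ∀ b c → b xor (b xor c) ≡ c
xor-involutive false c     = refl
xor-involutive true  false = refl
xor-involutive true  true  = refl

-- The inverse of v ↦ blend r (inc v) v: whether the increment carries
-- into an entry depends on the later entries only, so these can be
-- recovered from the last to the first.
unblend : ∀ {k} → ℕ → Vec Bool k → Vec Bool k
unblend zero    w       = w
unblend (suc r) []      = []
unblend (suc r) (b ∷ w) = (carry (unblend r w) xor b) ∷ unblend r w

blend-unblend : ∀ {k} r (w : Vec Bool k) → blend r (inc (unblend r w)) (unblend r w) ≡ w
blend-unblend zero    w       = refl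
blend-unblend (suc r) []      = refl
blend-unblend (suc r) (b ∷ w) = cong₂ _∷_ (xor-involutive (carry (unblend r w)) b) (blend-unblend r w)

unblend-blend : ∀ {k} r (v : Vec Bool k) → unblend r (blend r (inc v) v) ≡ v
unblend-blend zero    v       = refl
unblend-blend (suc r) []      = refl
unblend-blend (suc r) (b ∷ v) rewrite unblend-blend r v = cong (_∷ v) (xor-involutive (carry v) b)

-- Orientations of edges

pick : ∀ {n} → Bool → Edge n → Fin n
pick false = lo
pick true  = hi

∈ᵉ⇒pick : ∀ {n} {v : Fin n} e b → v ∈ᵉ e → v ≡ pick b e ⊎ v ≡ pick (not b) e
∈ᵉ⇒pick e false v∈e        = v∈e
∈ᵉ⇒pick e true (inj₁ v≡lo) = inj₂ v≡lo
∈ᵉ⇒pick e true (inj₂ v≡hi) = inj₁ v≡hi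

-- Splits an ordered pair of vertices into an edge, which the cycle has to supply, and a bit, which
-- row and pass have to supply. Uniqueness is what turns a reading of the torus back into a matching
-- and its flips.
record Orientation {n} (u v : Fin n) : Set where
  field
    support  : Edge n
    reversed : Bool
    upper    : pick reversed support ≡ u
    lower    : pick (not reversed) support ≡ v
    unique   : ∀ {e b} → pick b e ≡ u → pick (not b) e ≡ v → e ≡ support × b ≡ reversed

orient : ∀ {n} (u v : Fin n) → u ≢ v → Orientation u v
orient u v u≢v with Fin.<-cmp u v
... | tri≈ _ u≡v _ = contradiction u≡v u≢v
... | tri< u<v _ _ = record
  { support = edge u v u<v ; reversed = false ; upper = refl ; lower = refl ; unique = unique _ _ }
  where
  unique : ∀ e b → pick b e ≡ u → pick (not b) e ≡ v → e ≡ edge u v u<v × b ≡ false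
  unique (edge _ _ _)     false refl refl = refl , refl
  unique (edge _ _ lo<hi) true  refl refl = contradiction-irr lo<hi (Fin.<-asym u<v)
... | tri> _ _ v<u = record
  { support = edge v u v<u ; reversed = true ; upper = refl ; lower = refl ; unique = unique _ _ }
  where
  unique : ∀ e b → pick b e ≡ u → pick (not b) e ≡ v → e ≡ edge v u v<u × b ≡ true
  unique (edge _ _ _)     true  refl refl = refl , refl
  unique (edge _ _ lo<hi) false refl refl = contradiction-irr lo<hi (Fin.<-asym v<u)

-- The torus

mod-cong : ∀ a b d .{{_ : NonZero d}} → a % d ≡ b % d → a mod d ≡ b mod d
mod-cong a b d eq = fromℕ<-cong _ _ eq (m%n<n a d) (m%n<n b d)

toℕ-mod : ∀ a d .{{_ : NonZero d}} → toℕ (a mod d) ≡ a % d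
toℕ-mod a d = toℕ-fromℕ< (m%n<n a d)

lookup-cyclicWindow : ∀ {A : Set} {N} m (C : Fin N → A) i q → lookup (cyclicWindow m C i) q ≡ C (i ⊕ toℕ q)
lookup-cyclicWindow m C i q = lookup∘tabulate (λ q → C (i ⊕ toℕ q)) q

toℕ-⊕ : ∀ {N} (i : Fin N) q .{{_ : NonZero N}} → toℕ (i ⊕ q) ≡ (toℕ i + q) % N
toℕ-⊕ {N} i q = toℕ-fromℕ< (m%n<n (toℕ i + q) N {{nonZeroIndex i}})

flip : Fin 2 → Bool
flip Fin.zero    = false
flip (Fin.suc _) = true

fromFlip : Bool → Fin 2
fromFlip false = Fin.zero
fromFlip true  = Fin.suc Fin.zero

flip-fromFlip : ∀ b → flip (fromFlip b) ≡ b
flip-fromFlip false = refl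
flip-fromFlip true  = refl

fromFlip-flip : ∀ i → fromFlip (flip i) ≡ i
fromFlip-flip Fin.zero            = refl
fromFlip-flip (Fin.suc Fin.zero)  = refl

-- Whichever row a window starts in, its second row holds the opposite endpoints.
flip-⊕1 : ∀ i b → flip (i ⊕ 1) xor b ≡ not (flip i xor b)
flip-⊕1 Fin.zero           b     = refl
flip-⊕1 (Fin.suc Fin.zero) false = refl
flip-⊕1 (Fin.suc Fin.zero) true  = refl

module Torus (n k L N : ℕ) .{{L≢0 : NonZero L}} (m∣L : suc k ∣ L) (N≡2^k*L : N ≡ 2 ^ k * L)
             (C : Fin L → Edge n) where

  m : ℕ
  m = suc k

  -- The orientations in the x-th pass over C repeat this word of length m.
  word : ℕ → Vec Bool m
  word x = false ∷ count k x

  orientation : ℕ → Bool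
  orientation t = lookup (word (t / L)) (t mod m)

  torus : Array n N
  torus i j = pick (flip i xor orientation (toℕ j)) (C (toℕ j mod L))

  private
    instance
      N≢0 : NonZero N
      N≢0 = subst NonZero (sym N≡2^k*L) (m*n≢0 (2 ^ k) L {{m^n≢0 2 k}})

  L∣N : L ∣ N
  L∣N = divides (2 ^ k) N≡2^k*L

  m∣N : m ∣ N
  m∣N = ∣-trans m∣L L∣N

  m≤L : m ≤ L
  m≤L = ∣⇒≤ m∣L

  [a+x*L]/L : ∀ a x → (a + x * L) / L ≡ a / L + x
  [a+x*L]/L a x = trans (+-distrib-/-∣ʳ a (n∣m*n x)) (cong (a / L +_) (m*n/n≡m x L))

  m∣x*L : ∀ x → m ∣ x * L
  m∣x*L x = ∣n⇒∣m*n x m∣L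

  word-periodic : ∀ x c → word (x + c * 2 ^ k) ≡ word x
  word-periodic x c = cong (false ∷_) (count-periodic k x c)

  -- Column indices wrap modulo `N`. This is harmless to the position in the word, as `m` divides
  -- `N`, and shifts the pass by a multiple of `2 ^ k`.
  orientation-% : ∀ t → orientation (t % N) ≡ orientation t
  orientation-% t = sym (cong₂ lookup words (mod-cong t (t % N) m (sym (m∣n⇒o%n%m≡o%m m N t m∣N))))
    where
    open ≡-Reasoning
    words : word (t / L) ≡ word ((t % N) / L)
    words = begin
      word (t / L)                                  ≡⟨ cong (λ t → word (t / L)) (m≡m%n+[m/n]*n t N) ⟩
      word ((t % N + t / N * N) / L)                ≡⟨ cong (λ N′ → word ((t % N + t / N * N′) / L)) N≡2^k*L ⟩
      word ((t % N + t / N * (2 ^ k * L)) / L)      ≡⟨ cong (λ a → word ((t % N + a) / L)) (sym (*-assoc (t / N) (2 ^ k) L)) ⟩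
      word ((t % N + t / N * 2 ^ k * L) / L)        ≡⟨ cong word ([a+x*L]/L (t % N) (t / N * 2 ^ k)) ⟩
      word ((t % N) / L + t / N * 2 ^ k)            ≡⟨ word-periodic ((t % N) / L) (t / N) ⟩
      word ((t % N) / L)                            ∎

  -- The m consecutive orientations from position p of pass x are, up to
  -- rotation, the word of x with its initial entries replaced by those of
  -- the word of x + 1.

  blended : ℕ → ℕ → Vec Bool m
  blended x p = blend (p + m ∸ L) (word (suc x)) (word x)

  -- A window crosses the end of a pass only if it starts at `p = L ∸ m + r` with `r > 0`. Since `m`
  -- divides `L ∸ m`, its columns before the end have the residues `r`, `r + 1`, ... below `m`.
  unreplaced : ∀ p q → p + q < L → p + m ∸ L ≤ (p + q) % m
  unreplaced p q p+q<L with ≤-total (p + m) L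
  ... | inj₁ p+m≤L = subst (_≤ (p + q) % m) (sym (m≤n⇒m∸n≡0 p+m≤L)) z≤n
  ... | inj₂ L≤p+m = begin
    r                                ≤⟨ m≤m+n r q ⟩
    r + q                            ≡⟨ m<n⇒m%n≡m r+q<m ⟨
    (r + q) % m                      ≡⟨ %-remove-+ˡ (r + q) m∣L∸m ⟨
    (L ∸ m + (r + q)) % m            ≡⟨ cong (_% m) p+q≡ ⟨
    (p + q) % m                      ∎
    where
    open ≤-Reasoning
    r : ℕ
    r = p + m ∸ L
    m∣L∸m : m ∣ L ∸ m
    m∣L∸m = ∣m+n∣m⇒∣n (subst (m ∣_) (sym (m+[n∸m]≡n m≤L)) m∣L) n∣n
    p≡ : p ≡ L ∸ m + r
    p≡ = +-cancelʳ-≡ m p _ (begin-equality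
      p + m                ≡⟨ m∸n+n≡m L≤p+m ⟨
      r + L                ≡⟨ cong (r +_) (m∸n+n≡m m≤L) ⟨
      r + (L ∸ m + m)      ≡⟨ +-assoc r (L ∸ m) m ⟨
      r + (L ∸ m) + m      ≡⟨ cong (_+ m) (+-comm r (L ∸ m)) ⟩
      L ∸ m + r + m        ∎)
    p+q≡ : p + q ≡ L ∸ m + (r + q)
    p+q≡ = trans (cong (_+ q) p≡) (+-assoc (L ∸ m) r q)
    r+q<m : r + q < m
    r+q<m = +-cancelˡ-< (L ∸ m) _ _ (subst₂ _<_ p+q≡ (sym (m∸n+n≡m m≤L)) p+q<L)

  excess<m : ∀ p q → p < L → q < m → p + q ∸ L < m
  excess<m p q p<L q<m = m<n+o⇒m∸n<o (p + q) L (+-mono-< p<L q<m)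

  -- Behind the end of the pass the residues start again at 0, because `m` divides `L`.
  replaced : ∀ p q → p < L → q < m → L ≤ p + q → (p + q) % m < p + m ∸ L
  replaced p q p<L q<m L≤p+q = begin-strict
    (p + q) % m                      ≡⟨ cong (_% m) (m+[n∸m]≡n L≤p+q) ⟨
    (L + (p + q ∸ L)) % m            ≡⟨ %-remove-+ˡ (p + q ∸ L) m∣L ⟩
    (p + q ∸ L) % m                  ≡⟨ m<n⇒m%n≡m (excess<m p q p<L q<m) ⟩
    p + q ∸ L                        <⟨ ∸-monoˡ-< (+-monoʳ-< p q<m) L≤p+q ⟩
    p + m ∸ L                        ∎
    where open ≤-Reasoning

  orientation-window : ∀ x p q → p < L → q < m →
                       orientation (p + q + x * L) ≡ lookup (blended x p) ((p + q) mod m)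
  orientation-window x p q p<L q<m = trans
    (cong₂ lookup (cong word ([a+x*L]/L (p + q) x)) (mod-cong (p + q + x * L) (p + q) m (%-remove-+ʳ (p + q) (m∣x*L x))))
    (sym blended≡)
    where
    s : Fin m
    s = (p + q) mod m
    blended≡ : lookup (blended x p) s ≡ lookup (word ((p + q) / L + x)) s
    blended≡ with p + q <? L
    ... | yes p+q<L rewrite m<n⇒m/n≡0 p+q<L =
      lookup-blend-≥ (p + m ∸ L) (word (suc x)) (word x) s
        (subst (p + m ∸ L ≤_) (sym (toℕ-mod (p + q) m)) (unreplaced p q p+q<L))
    -- As `m ≤ L`, a window meets at most one further pass, so the quotient is exactly 1.
    ... | no p+q≮L rewrite m/n≡1+[m∸n]/n (≮⇒≥ p+q≮L)
                         | m<n⇒m/n≡0 (<-≤-trans (excess<m p q p<L q<m) m≤L) =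
      lookup-blend-< (p + m ∸ L) (word (suc x)) (word x) s
        (subst (_< p + m ∸ L) (sym (toℕ-mod (p + q) m)) (replaced p q p<L q<m (≮⇒≥ p+q≮L)))

  -- Solves for row and pass when the matching has fixed the position: `r` entries are replaced, and
  -- `c s` is the bit demanded of the column with residue `s` modulo `m`.
  module Decode (r : ℕ) (c : Fin m → Bool) where

    -- All words have `false` at residue 0, so the bit demanded there is the row. Taking the other
    -- bits relative to it removes the effect of the row.
    target : Vec Bool k
    target = tabulate (λ s → c Fin.zero xor c (Fin.suc s))

    flip* : Fin 2
    flip* = fromFlip (c Fin.zero)

    pass* : ℕ
    pass* = value (unblend (pred r) target)

    Decodes : Fin 2 → ℕ → Set
    Decodes i x = ∀ s → flip i xor lookup (blend r (word (suc x)) (word x)) s ≡ c s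

    -- The constant leading bit uses up one of the replaced entries, if there are any; hence
    -- `pred r` for the counter proper.
    blend-false∷ : ∀ r (v′ v : Vec Bool k) → blend r (false ∷ v′) (false ∷ v) ≡ false ∷ blend (pred r) v′ v
    blend-false∷ zero    v′ v = refl
    blend-false∷ (suc r) v′ v = refl

    pass*<2^k : pass* < 2 ^ k
    pass*<2^k = value<2^k (unblend (pred r) target)

    decodes : Decodes flip* pass*
    decodes s rewrite blend-false∷ r (count k (suc pass*)) (count k pass*)
                    | count-value (unblend (pred r) target)
                    | blend-unblend (pred r) target
                    | flip-fromFlip (c Fin.zero) = at s
      where
      at : ∀ s → c Fin.zero xor lookup (false ∷ target) s ≡ c s
      at Fin.zero    = xor-identityʳ (c Fin.zero)
      at (Fin.suc s) = trans (cong (c Fin.zero xor_) (lookup∘tabulate _ s)) (xor-involutive (c Fin.zero) _)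

    decode-unique : ∀ {i x} → x < 2 ^ k → Decodes i x → flip* ≡ i × pass* ≡ x
    decode-unique {i} {x} x<2^k dec = trans (cong fromFlip c₀≡) (fromFlip-flip i) , pass*≡x
      where
      open ≡-Reasoning
      dec′ : ∀ s → flip i xor lookup (false ∷ blend (pred r) (count k (suc x)) (count k x)) s ≡ c s
      dec′ s = subst (λ v → flip i xor lookup v s ≡ c s) (blend-false∷ r _ _) (dec s)
      c₀≡ : c Fin.zero ≡ flip i
      c₀≡ = trans (sym (dec′ Fin.zero)) (xor-identityʳ (flip i))
      target≡ : target ≡ blend (pred r) (count k (suc x)) (count k x)
      target≡ = trans (tabulate-cong λ s →
          trans (cong₂ _xor_ c₀≡ (sym (dec′ (Fin.suc s)))) (xor-involutive (flip i) _))
        (tabulate∘lookup _)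
      pass*≡x : pass* ≡ x
      pass*≡x = begin
        value (unblend (pred r) target)                ≡⟨ cong (value ∘ unblend (pred r)) target≡ ⟩
        value (unblend (pred r) (blend (pred r) (inc (count k x)) (count k x)))
                                                       ≡⟨ cong value (unblend-blend (pred r) (count k x)) ⟩
        value (count k x)                              ≡⟨ value-count k x x<2^k ⟩
        x                                              ∎

  position<N : ∀ (p : Fin L) {x} → x < 2 ^ k → toℕ p + x * L < N
  position<N p {x} x<2^k = begin-strict
    toℕ p + x * L     <⟨ +-monoˡ-< (x * L) (toℕ<n p) ⟩
    suc x * L         ≤⟨ *-monoˡ-≤ L x<2^k ⟩
    2 ^ k * L         ≡⟨ N≡2^k*L ⟨
    N                 ∎
    where open ≤-Reasoning

  ⊕-mod : ∀ (j : Fin N) q → toℕ (j ⊕ q) mod L ≡ (toℕ j mod L) ⊕ q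
  ⊕-mod j q = toℕ-injective (begin
    toℕ (toℕ (j ⊕ q) mod L)             ≡⟨ toℕ-mod (toℕ (j ⊕ q)) L ⟩
    toℕ (j ⊕ q) % L                     ≡⟨ cong (_% L) (toℕ-⊕ j q) ⟩
    (toℕ j + q) % N % L                 ≡⟨ m∣n⇒o%n%m≡o%m L N (toℕ j + q) L∣N ⟩
    (toℕ j + q) % L                     ≡⟨ cong (λ t → (t + q) % L) (m≡m%n+[m/n]*n (toℕ j) L) ⟩
    (toℕ j % L + x * L + q) % L         ≡⟨ cong (_% L) (+-assoc (toℕ j % L) (x * L) q) ⟩
    (toℕ j % L + (x * L + q)) % L       ≡⟨ cong (λ a → (toℕ j % L + a) % L) (+-comm (x * L) q) ⟩
    (toℕ j % L + (q + x * L)) % L       ≡⟨ cong (_% L) (+-assoc (toℕ j % L) q (x * L)) ⟨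
    (toℕ j % L + q + x * L) % L         ≡⟨ %-remove-+ʳ (toℕ j % L + q) (n∣m*n x) ⟩
    (toℕ j % L + q) % L                 ≡⟨ cong (λ p → (p + q) % L) (toℕ-mod (toℕ j) L) ⟨
    (toℕ (toℕ j mod L) + q) % L         ≡⟨ toℕ-⊕ (toℕ j mod L) q ⟨
    toℕ ((toℕ j mod L) ⊕ q)             ∎)
    where
    open ≡-Reasoning
    x : ℕ
    x = toℕ j / L

  orientation-⊕ : ∀ (j : Fin N) (q : Fin m) → orientation (toℕ (j ⊕ toℕ q)) ≡
    lookup (blended (toℕ j / L) (toℕ j % L)) ((toℕ j % L + toℕ q) mod m)
  orientation-⊕ j q = begin
    orientation (toℕ (j ⊕ toℕ q))                   ≡⟨ cong orientation (toℕ-⊕ j (toℕ q)) ⟩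
    orientation ((toℕ j + toℕ q) % N)               ≡⟨ orientation-% (toℕ j + toℕ q) ⟩
    orientation (toℕ j + toℕ q)                     ≡⟨ cong (λ t → orientation (t + toℕ q)) (m≡m%n+[m/n]*n (toℕ j) L) ⟩
    orientation (p + x * L + toℕ q)                 ≡⟨ cong orientation (+-assoc p (x * L) (toℕ q)) ⟩
    orientation (p + (x * L + toℕ q))               ≡⟨ cong (λ a → orientation (p + a)) (+-comm (x * L) (toℕ q)) ⟩
    orientation (p + (toℕ q + x * L))               ≡⟨ cong orientation (+-assoc p (toℕ q) (x * L)) ⟨
    orientation (p + toℕ q + x * L)                 ≡⟨ orientation-window x p (toℕ q) (m%n<n (toℕ j) L) (toℕ<n q) ⟩
    lookup (blended x p) ((p + toℕ q) mod m)        ∎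
    where
    open ≡-Reasoning
    x p : ℕ
    x = toℕ j / L
    p = toℕ j % L

  -- rotate p inverts q ↦ (p + q) mod m, because p + p * k = p * m.
  rotate : ℕ → Fin m → Fin m
  rotate p s = (toℕ s + p * k) mod m

  shift-rotate : ∀ p s → (p + toℕ (rotate p s)) mod m ≡ s
  shift-rotate p s = toℕ-injective (begin
    toℕ ((p + toℕ (rotate p s)) mod m)              ≡⟨ toℕ-mod (p + toℕ (rotate p s)) m ⟩
    (p + toℕ (rotate p s)) % m                      ≡⟨ cong (λ a → (p + a) % m) (toℕ-mod (toℕ s + p * k) m) ⟩
    (p + (toℕ s + p * k) % m) % m                   ≡⟨ %-distribˡ-+ p _ m ⟩
    (p % m + (toℕ s + p * k) % m % m) % m           ≡⟨ cong (λ a → (p % m + a) % m) (m%n%n≡m%n (toℕ s + p * k) m) ⟩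
    (p % m + (toℕ s + p * k) % m) % m               ≡⟨ %-distribˡ-+ p (toℕ s + p * k) m ⟨
    (p + (toℕ s + p * k)) % m                       ≡⟨ cong (_% m) (regroup p (toℕ s) k) ⟩
    (toℕ s + p * m) % m                             ≡⟨ [m+kn]%n≡m%n (toℕ s) p m ⟩
    toℕ s % m                                       ≡⟨ m<n⇒m%n≡m (toℕ<n s) ⟩
    toℕ s                                           ∎)
    where
    open ≡-Reasoning
    regroup : ∀ p s k → p + (s + p * k) ≡ s + p * suc k
    regroup = solve-∀

  rotate-shift : ∀ p q → rotate p ((p + toℕ q) mod m) ≡ q
  rotate-shift p q = toℕ-injective (begin
    toℕ (rotate p s)                                ≡⟨ toℕ-mod (toℕ s + p * k) m ⟩
    (toℕ s + p * k) % m                             ≡⟨ cong (λ a → (a + p * k) % m) (toℕ-mod (p + toℕ q) m) ⟩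
    ((p + toℕ q) % m + p * k) % m                   ≡⟨ %-distribˡ-+ ((p + toℕ q) % m) (p * k) m ⟩
    ((p + toℕ q) % m % m + (p * k) % m) % m         ≡⟨ cong (λ a → (a + (p * k) % m) % m) (m%n%n≡m%n (p + toℕ q) m) ⟩
    ((p + toℕ q) % m + (p * k) % m) % m             ≡⟨ %-distribˡ-+ (p + toℕ q) (p * k) m ⟨
    (p + toℕ q + p * k) % m                         ≡⟨ cong (_% m) (regroup p (toℕ q) k) ⟩
    (toℕ q + p * m) % m                             ≡⟨ [m+kn]%n≡m%n (toℕ q) p m ⟩
    toℕ q % m                                       ≡⟨ m<n⇒m%n≡m (toℕ<n q) ⟩
    toℕ q                                           ∎)
    where
    open ≡-Reasoning
    s : Fin m
    s = (p + toℕ q) mod m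
    regroup : ∀ p q k → p + q + p * k ≡ q + p * suc k
    regroup = solve-∀

  -- Each word is read at exactly one position

  module Universal
    (C-universal : (M : Vec (Edge n) m) → IsOrderedMatching M → ∃! _≡_ λ i → cyclicWindow m C i ≡ M)
    (w : Vec (Fin n) (m + m)) (w-unique : Unique w) where

    open Orientation

    u v : Fin m → Fin n
    u q = lookup w (q ↑ˡ m)
    v q = lookup w (m ↑ʳ q)

    ↑ˡ≢↑ʳ : ∀ (a b : Fin m) → a ↑ˡ m ≢ m ↑ʳ b
    ↑ˡ≢↑ʳ a b eq = <⇒≢ (<-≤-trans (toℕ<n a) (m≤m+n m (toℕ b)))
      (trans (sym (Fin.toℕ-↑ˡ a m)) (trans (cong toℕ eq) (Fin.toℕ-↑ʳ m b)))

    u≢v : ∀ a b → u a ≢ v b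
    u≢v a b eq = ↑ˡ≢↑ʳ a b (lookup-injective w-unique (a ↑ˡ m) (m ↑ʳ b) eq)

    oriented : ∀ q → Orientation (u q) (v q)
    oriented q = orient (u q) (v q) (u≢v q q)

    matching : Vec (Edge n) m
    matching = tabulate (λ q → support (oriented q))

    ∈ᵉ⇒u⊎v : ∀ {a} q → a ∈ᵉ support (oriented q) → a ≡ u q ⊎ a ≡ v q
    ∈ᵉ⇒u⊎v q a∈ with ∈ᵉ⇒pick (support (oriented q)) (reversed (oriented q)) a∈
    ... | inj₁ eq = inj₁ (trans eq (upper (oriented q)))
    ... | inj₂ eq = inj₂ (trans eq (lower (oriented q)))

    isOrderedMatching : IsOrderedMatching matching
    isOrderedMatching = AllPairs.tabulate⁺ {f = λ q → support (oriented q)} disjoint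
      where
      disjoint : ∀ {a b} → a ≢ b → VertexDisjoint (support (oriented a)) (support (oriented b))
      disjoint {a} {b} a≢b x x∈a x∈b with ∈ᵉ⇒u⊎v a x∈a | ∈ᵉ⇒u⊎v b x∈b
      ... | inj₁ x≡u | inj₂ x≡v = u≢v a b (trans (sym x≡u) x≡v)
      ... | inj₂ x≡v | inj₁ x≡u = u≢v b a (trans (sym x≡u) x≡v)
      ... | inj₁ x≡a | inj₁ x≡b =
        a≢b (Fin.↑ˡ-injective m a b (lookup-injective w-unique _ _ (trans (sym x≡a) x≡b)))
      ... | inj₂ x≡a | inj₂ x≡b =
        a≢b (Fin.↑ʳ-injective m a b (lookup-injective w-unique _ _ (trans (sym x≡a) x≡b)))

    place : Fin L
    place = proj₁ (C-universal matching isOrderedMatching)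

    place-matches : ∀ q → C (place ⊕ toℕ q) ≡ support (oriented q)
    place-matches q = begin
      C (place ⊕ toℕ q)                     ≡⟨ lookup-cyclicWindow m C place q ⟨
      lookup (cyclicWindow m C place) q     ≡⟨ cong (λ M → lookup M q) (proj₁ (proj₂ (C-universal matching isOrderedMatching))) ⟩
      lookup matching q                     ≡⟨ lookup∘tabulate (λ q → support (oriented q)) q ⟩
      support (oriented q)                  ∎
      where open ≡-Reasoning

    place-unique : ∀ {p} → (∀ q → C (p ⊕ toℕ q) ≡ support (oriented q)) → place ≡ p
    place-unique eq = proj₂ (proj₂ (C-universal matching isOrderedMatching)) (tabulate-cong eq)

    -- In the window at `place`, the column with residue `s` is the one with offset
    -- `rotate (toℕ place) s`; the demanded bits are indexed by residue.
    open Decode (toℕ place + m ∸ L) (λ s → reversed (oriented (rotate (toℕ place) s)))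

    column* : Fin N
    column* = fromℕ< (position<N place pass*<2^k)

    Reads : Fin 2 → Fin N → Set
    Reads i j = ∀ q → torus i (j ⊕ toℕ q) ≡ u q × torus (i ⊕ 1) (j ⊕ toℕ q) ≡ v q

    Reads⇒rowMajor : ∀ i j → Reads i j → rowMajor m torus i j ≡ w
    Reads⇒rowMajor i j reads = trans (sym (tabulate∘lookup _)) (trans (tabulate-cong entry) (tabulate∘lookup w))
      where
      top bottom : Vec (Fin n) m
      top    = cyclicWindow m (torus i) j
      bottom = cyclicWindow m (torus (i ⊕ 1)) j
      entry : ∀ a → lookup (rowMajor m torus i j) a ≡ lookup w a
      entry a with Fin.splitAt m a | Fin.join-splitAt m m a
      ... | inj₁ q | refl =
        trans (lookup-++ˡ top bottom q) (trans (lookup-cyclicWindow m (torus i) j q) (proj₁ (reads q)))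
      ... | inj₂ q | refl =
        trans (lookup-++ʳ top bottom q) (trans (lookup-cyclicWindow m (torus (i ⊕ 1)) j q) (proj₂ (reads q)))

    rowMajor⇒Reads : ∀ i j → rowMajor m torus i j ≡ w → Reads i j
    rowMajor⇒Reads i j refl q =
      sym (trans (lookup-++ˡ top bottom q) (lookup-cyclicWindow m (torus i) j q)) ,
      sym (trans (lookup-++ʳ top bottom q) (lookup-cyclicWindow m (torus (i ⊕ 1)) j q))
      where
      top bottom : Vec (Fin n) m
      top    = cyclicWindow m (torus i) j
      bottom = cyclicWindow m (torus (i ⊕ 1)) j

    -- Separates a reading into edges, which determine `place`, and flips, which determine row and
    -- pass.
    Matches : Fin 2 → Fin N → Set
    Matches i j = ∀ q → C ((toℕ j mod L) ⊕ toℕ q) ≡ support (oriented q)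
                      × flip i xor orientation (toℕ (j ⊕ toℕ q)) ≡ reversed (oriented q)

    Matches⇒Reads : ∀ i j → Matches i j → Reads i j
    Matches⇒Reads i j matches q =
      trans (cong₂ pick b≡ e≡) (upper (oriented q)) ,
      trans (cong₂ pick (trans (flip-⊕1 i _) (cong not b≡)) e≡) (lower (oriented q))
      where
      e≡ : C (toℕ (j ⊕ toℕ q) mod L) ≡ support (oriented q)
      e≡ = trans (cong C (⊕-mod j (toℕ q))) (proj₁ (matches q))
      b≡ : flip i xor orientation (toℕ (j ⊕ toℕ q)) ≡ reversed (oriented q)
      b≡ = proj₂ (matches q)

    Reads⇒Matches : ∀ i j → Reads i j → Matches i j
    Reads⇒Matches i j reads q = trans (cong C (sym (⊕-mod j (toℕ q)))) (proj₁ e≡×b≡) , proj₂ e≡×b≡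
      where
      e : Edge n
      e = C (toℕ (j ⊕ toℕ q) mod L)
      b : Bool
      b = orientation (toℕ (j ⊕ toℕ q))
      e≡×b≡ : e ≡ support (oriented q) × flip i xor b ≡ reversed (oriented q)
      e≡×b≡ = unique (oriented q) (proj₁ (reads q))
        (trans (cong (λ b → pick b e) (sym (flip-⊕1 i b))) (proj₂ (reads q)))

    column*/L : toℕ column* / L ≡ pass*
    column*/L = trans (cong (_/ L) (toℕ-fromℕ< (position<N place pass*<2^k)))
      (trans ([a+x*L]/L (toℕ place) pass*) (cong (_+ pass*) (m<n⇒m/n≡0 (toℕ<n place))))

    column*%L : toℕ column* % L ≡ toℕ place
    column*%L = trans (cong (_% L) (toℕ-fromℕ< (position<N place pass*<2^k)))
      (trans ([m+kn]%n≡m%n (toℕ place) pass* L) (m<n⇒m%n≡m (toℕ<n place)))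

    matches* : Matches flip* column*
    matches* q = trans (cong (λ p → C (p ⊕ toℕ q)) column*modL) (place-matches q) , (begin
      flip flip* xor orientation (toℕ (column* ⊕ toℕ q))
        ≡⟨ cong (flip flip* xor_) (orientation-⊕ column* q) ⟩
      flip flip* xor lookup (blended (toℕ column* / L) (toℕ column* % L)) ((toℕ column* % L + toℕ q) mod m)
        ≡⟨ cong₂ (λ x p → flip flip* xor lookup (blended x p) ((p + toℕ q) mod m)) column*/L column*%L ⟩
      flip flip* xor lookup (blended pass* p) ((p + toℕ q) mod m)
        ≡⟨ decodes ((p + toℕ q) mod m) ⟩
      reversed (oriented (rotate p ((p + toℕ q) mod m)))
        ≡⟨ cong (λ q → reversed (oriented q)) (rotate-shift p q) ⟩
      reversed (oriented q) ∎)
      where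
      open ≡-Reasoning
      p : ℕ
      p = toℕ place
      column*modL : toℕ column* mod L ≡ place
      column*modL = toℕ-injective (trans (toℕ-mod (toℕ column*) L) column*%L)

    matches-unique : ∀ i j → Matches i j → flip* ≡ i × column* ≡ j
    matches-unique i j matches = proj₁ flip×pass , toℕ-injective (begin
      toℕ column*                   ≡⟨ toℕ-fromℕ< (position<N place pass*<2^k) ⟩
      toℕ place + pass* * L         ≡⟨ cong₂ (λ p x → p + x * L) place≡ (proj₂ flip×pass) ⟩
      toℕ j % L + toℕ j / L * L     ≡⟨ m≡m%n+[m/n]*n (toℕ j) L ⟨
      toℕ j                         ∎)
      where
      open ≡-Reasoning
      place≡ : toℕ place ≡ toℕ j % L
      place≡ = trans (cong toℕ (place-unique (proj₁ ∘ matches))) (toℕ-mod (toℕ j) L)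
      pass<2^k : toℕ j / L < 2 ^ k
      pass<2^k = m<n*o⇒m/o<n (subst (toℕ j <_) N≡2^k*L (toℕ<n j))
      -- Every residue is attained by some offset, by `shift-rotate`, so the flips in the window
      -- cover all `s`.
      decode : Decodes i (toℕ j / L)
      decode s = begin
        flip i xor lookup (blended x p) s
          ≡⟨ cong (λ s → flip i xor lookup (blended x p) s) (shift-rotate p s) ⟨
        flip i xor lookup (blended x p) ((p + toℕ q) mod m)
          ≡⟨ cong₂ (λ p′ p″ → flip i xor lookup (blended x p′) ((p″ + toℕ q) mod m)) place≡ place≡ ⟩
        flip i xor lookup (blended x (toℕ j % L)) ((toℕ j % L + toℕ q) mod m)
          ≡⟨ cong (flip i xor_) (orientation-⊕ j q) ⟨
        flip i xor orientation (toℕ (j ⊕ toℕ q))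
          ≡⟨ proj₂ (matches q) ⟩
        reversed (oriented q) ∎
        where
        x p : ℕ
        x = toℕ j / L
        p = toℕ place
        q : Fin m
        q = rotate p s
      flip×pass : flip* ≡ i × pass* ≡ toℕ j / L
      flip×pass = decode-unique pass<2^k decode

    torus-universal : ∃! _≡_ λ ((i , j) : Fin 2 × Fin N) → rowMajor m torus i j ≡ w
    torus-universal = (flip* , column*) , Reads⇒rowMajor flip* column* (Matches⇒Reads flip* column* matches*) ,
      λ {(i , j)} reads → let (i≡ , j≡) = matches-unique i j (Reads⇒Matches i j (rowMajor⇒Reads i j reads))
                          in cong₂ _,_ i≡ j≡

-- Bounded executions

get-≤ : ∀ {B} {xs : List ℕ} → All (_≤ B) xs → ∀ a → get xs a ≤ B
get-≤ []             zero    = z≤n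
get-≤ []             (suc a) = z≤n
get-≤ (x≤B ∷ _)      zero    = x≤B
get-≤ (_ ∷ xs≤B)     (suc a) = get-≤ xs≤B a

set-≤ : ∀ {B v X} → All (_≤ B) X → ∀ i → v ≤ B → All (_≤ B) (set X i v)
set-≤ []         zero    v≤B = v≤B ∷ []
set-≤ []         (suc i) v≤B = z≤n ∷ set-≤ [] i v≤B
set-≤ (_ ∷ X≤B)  zero    v≤B = v≤B ∷ X≤B
set-≤ (x≤B ∷ X≤B) (suc i) v≤B = x≤B ∷ set-≤ X≤B i v≤B

length-set : ∀ {n} X {i v} → length X ≤ n → i < n → length (set X i v) ≤ n
length-set []      {zero}  _           i<n       = i<n
length-set []      {suc i} _           (s≤s i<n) = s≤s (length-set [] z≤n i<n)
length-set (x ∷ X) {zero}  X≤n         _         = X≤n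
length-set (x ∷ X) {suc i} (s≤s X≤n)   (s≤s i<n) = s≤s (length-set X X≤n i<n)

module Execution (P : Program) (cells : ℕ) (inp : List ℕ) (B : ℕ) (inp≤B : All (_≤ B) inp) where

  Bounded : Memory → Set
  Bounded X = All (_≤ B) X × length X ≤ cells

  bits : ℕ
  bits = cells * suc ⌈log₂ suc B ⌉

  space≤ : ∀ s → Bounded (mem s) → space s ≤ bits
  space≤ s (X≤B , X≤cells) = ≤-trans (sum≤ X≤B) (*-monoˡ-≤ (suc ⌈log₂ suc B ⌉) X≤cells)
    where
    sum≤ : ∀ {X} → All (_≤ B) X → sum (map (λ x → suc ⌈log₂ suc x ⌉) X) ≤ length X * suc ⌈log₂ suc B ⌉
    sum≤ []          = z≤n
    sum≤ (x≤B ∷ X≤B) = +-mono-≤ (s≤s (⌈log₂⌉-mono-≤ (s≤s x≤B))) (sum≤ X≤B)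

  -- In Halts s t o, t is only an upper bound on the number of steps, and o
  -- has the most recent word first.
  data Halts : Config → ℕ → List ℕ → Set where
    halt : ∀ {s t} → Bounded (mem s) → fetch P s ≡ nothing → Halts s t (out s)
    next : ∀ {s t I o} → Bounded (mem s) → fetch P s ≡ just I → Halts (exec inp I s) t o → Halts s (suc t) o

  weaken : ∀ {s t t′ o} → t ≤ t′ → Halts s t o → Halts s t′ o
  weaken _          (halt X≤ end)      = halt X≤ end
  weaken (s≤s t≤t′) (next X≤ fetched h) = next X≤ fetched (weaken t≤t′ h)

  Halts⇒Run : ∀ {s t o b} → bits ≤ b → Halts s t o →
    Σ[ final ∈ Config ] Σ[ steps ∈ ℕ ] (steps ≤ t × Run P inp b s steps final × out final ≡ o)
  Halts⇒Run {s} bits≤b (halt X≤ end) = s , 0 , z≤n , halt (≤-trans (space≤ s X≤) bits≤b) end , refl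
  Halts⇒Run {s} bits≤b (next X≤ fetched h) with Halts⇒Run bits≤b h
  ... | final , steps , steps≤ , run , out≡ =
    final , suc steps , s≤s steps≤ , next (≤-trans (space≤ s X≤) bits≤b) fetched run , out≡

  -- Of all instructions only `const` and `add` can create a number above `B`. The Boolean test
  -- makes the address condition compute to the unit type for concrete registers.
  Safe : Instr → Memory → Set
  Safe (const i c) X = T (i <ᵇ cells) × c ≤ B
  Safe (add i j k) X = T (i <ᵇ cells) × get X j + get X k ≤ B
  Safe (sub i j k) X = T (i <ᵇ cells)
  Safe (load i j)  X = T (i <ᵇ cells)
  Safe (store i j) X = T (get X i <ᵇ cells)
  Safe (read i j)  X = T (i <ᵇ cells)
  Safe (write i)   X = ⊤
  Safe (jump l)    X = ⊤
  Safe (jzero i l) X = ⊤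

  set-bounded : ∀ {X v} i → T (i <ᵇ cells) → v ≤ B → Bounded X → Bounded (set X i v)
  set-bounded {X} i i< v≤B (X≤B , X≤cells) = set-≤ X≤B i v≤B , length-set X X≤cells (<ᵇ⇒< i cells i<)

  exec-bounded : ∀ I s → Safe I (mem s) → Bounded (mem s) → Bounded (mem (exec inp I s))
  exec-bounded (const i c) (config p X o) (i< , c≤B) X≤ = set-bounded i i< c≤B X≤
  exec-bounded (add i j k) (config p X o) (i< , v≤B) X≤ = set-bounded i i< v≤B X≤
  exec-bounded (sub i j k) (config p X o) i< X≤ =
    set-bounded i i< (≤-trans (m∸n≤m (get X j) (get X k)) (get-≤ (proj₁ X≤) j)) X≤
  exec-bounded (load i j)  (config p X o) i< X≤ = set-bounded i i< (get-≤ (proj₁ X≤) (get X j)) X≤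
  exec-bounded (store i j) (config p X o) i< X≤ = set-bounded (get X i) i< (get-≤ (proj₁ X≤) j) X≤
  exec-bounded (read i j)  (config p X o) i< X≤ = set-bounded i i< (get-≤ inp≤B (get X j)) X≤
  exec-bounded (write i)   (config p X o) _  X≤ = X≤
  exec-bounded (jump l)    (config p X o) _  X≤ = X≤
  exec-bounded (jzero i l) (config p X o) _  X≤ with get X i
  ... | zero  = X≤
  ... | suc _ = X≤

  -- With boundedness as a premise, `step` carries the invariant forward, and symbolic executions
  -- only supply `Safe`.
  HaltsFrom : Config → ℕ → List ℕ → Set
  HaltsFrom s t o = Bounded (mem s) → Halts s t o

  relax : ∀ {s t o} n → HaltsFrom s t o → HaltsFrom s (n + t) o
  relax n h X≤ = weaken (m≤n+m _ n) (h X≤)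

  step : ∀ {s t I o} → fetch P s ≡ just I → Safe I (mem s) →
         HaltsFrom (exec inp I s) t o → HaltsFrom s (suc t) o
  step {s} {I = I} fetched safe h X≤ = next X≤ fetched (h (exec-bounded I s safe X≤))

-- The registers are 0: y, 1: input address, 2: columns left in the
-- pass, 3: passes left, 4: K, 5: L, 6: one, 7: two and 8–10: scratch, with
-- the endpoints of the current edge in 9 and 10.  A column doubles y < K
-- and, if the result is at least K, subtracts K − 1: this rotates the m-bit
-- word of y, where K = 2 ^ m, and the leading bit decides the orientation.
-- After the pass, y has its initial value again and is incremented.

program : Program
program =
    -- Writing the last cell at once makes the memory a list of eleven explicit cells from here on.
    const 10 0 ∷ const 6 1 ∷ const 7 2 ∷ const 4 1
  ∷ read 8 0 ∷ read 5 6 ∷ sub 8 8 6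
  -- 7: double K for each 2 in n - 1, keeping K / 2 in register 3
  ∷ jzero 8 13 ∷ const 3 0 ∷ add 3 3 4 ∷ add 4 4 4 ∷ sub 8 8 7 ∷ jump 7
  -- 13: start of a pass
  ∷ const 1 2 ∷ const 2 0 ∷ add 2 2 5
  -- 16: start of a column
  ∷ read 9 1 ∷ add 8 6 1 ∷ read 10 8
  -- After the doubling, `2y + 1 ∸ K` is positive exactly if `2y ≥ K`, and it is then the reduced
  -- value `2y - (K - 1)` itself.
  ∷ add 0 0 0 ∷ add 8 6 0 ∷ sub 8 8 4 ∷ jzero 8 28
  ∷ write 10 ∷ write 9 ∷ const 0 0 ∷ add 0 0 8 ∷ jump 30
  -- 28: leading bit 0
  ∷ write 9 ∷ write 10
  -- 30: end of a column
  ∷ add 1 7 1 ∷ sub 2 2 6 ∷ jzero 2 34 ∷ jump 16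
  -- 34: end of a pass
  ∷ add 0 6 0 ∷ sub 3 3 6 ∷ jzero 3 38 ∷ jump 13
  ∷ []

-- Symbolic execution of the program

emit : Bool → ℕ → ℕ → List ℕ → List ℕ
emit false l h o = h ∷ l ∷ o
emit true  l h o = l ∷ h ∷ o

double^ : ℕ → ℕ → ℕ
double^ zero    p = p
double^ (suc r) p = double^ r (p + p)

double^≡ : ∀ r p → double^ r p ≡ 2 ^ r * p
double^≡ zero    p = sym (*-identityˡ p)
double^≡ (suc r) p = trans (double^≡ r (p + p)) (regroup (2 ^ r) p)
  where
  regroup : ∀ q p → q * (p + p) ≡ 2 * q * p
  regroup = solve-∀

≤double^ : ∀ r p → p ≤ double^ r p
≤double^ zero    p = ≤-refl
≤double^ (suc r) p = ≤-trans (m≤m+n p p) (≤double^ r (p + p))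

-- Apart from input words, the largest numbers in cells are `2 + 2L`, the input address after the
-- last edge, and `2y + 1` with `y < K = 2H`.
module Machine (inp : List ℕ) (B : ℕ) (inp≤B : All (_≤ B) inp) (k l : ℕ)
               (2+2L≤B : 2 + suc l * 2 ≤ B) (4H≤B : 2 ^ k + 2 ^ k + (2 ^ k + 2 ^ k) ≤ B) where

  open Execution program 11 inp B inp≤B

  L H : ℕ
  L = suc l
  H = 2 ^ k

  registers : (y a c d K t u v : ℕ) → Memory
  registers y a c d K t u v = y ∷ a ∷ c ∷ d ∷ K ∷ L ∷ 1 ∷ 2 ∷ t ∷ u ∷ v ∷ []

  2≤B : 2 ≤ B
  2≤B = ≤-trans (m≤m+n 2 (L * 2)) 2+2L≤B

  L≤B : L ≤ B
  L≤B = ≤-trans (m≤m*n L 2) (≤-trans (m≤n+m (L * 2) 2) 2+2L≤B)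

  doubling : ∀ r {p d t o} → let q = double^ r p in q + q ≤ B →
             HaltsFrom (config 13 (registers 0 0 0 q (q + q) 0 0 0) []) t o →
             HaltsFrom (config 7 (registers 0 0 0 d p (suc r * 2) 0 0) []) (suc r * 6 + suc t) o
  doubling zero    {p} 2p≤B h =
    step refl _ (step refl (_ , z≤n) (step refl (_ , ≤-trans (m≤m+n p p) 2p≤B) (step refl (_ , 2p≤B)
    (step refl _ (step refl _ (step refl _ h))))))
  doubling (suc r) {p} 2q≤B h =
    step refl _ (step refl (_ , z≤n) (step refl (_ , ≤-trans (m≤m+n p p) 2p≤B) (step refl (_ , 2p≤B)
    (step refl _ (step refl _ (doubling r 2q≤B h))))))
    where
    2p≤B : p + p ≤ B
    2p≤B = ≤-trans (≤-trans (≤double^ r (p + p)) (m≤m+n _ _)) 2q≤B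

  column-end : ∀ {y a c d K x u v O t o} → 2 + a ≤ B →
    (∀ x u v → HaltsFrom (config 32 (registers y (2 + a) c d K x u v) O) t o) →
    HaltsFrom (config 30 (registers y a (suc c) d K x u v) O) (2 + t) o
  column-end 2+a≤B h = step refl (_ , 2+a≤B) (step refl _ (h _ _ _))

  -- The form `bit b * suc (z + z)` lets the case split on `b` decide the `jzero`. The sides take 5
  -- and 8 steps, and the shorter one is padded.
  branch : ∀ b z {y a c d K x u v O t o} → 2 + a ≤ B → suc (z + z) ≤ B →
    (b ≡ false → y ≡ z + z) → x ≡ bit b * suc (z + z) →
    (∀ x u′ v′ → HaltsFrom (config 32 (registers (bit b + (z + z)) (2 + a) c d K x u′ v′) (emit b u v O)) t o) →
    HaltsFrom (config 22 (registers y a (suc c) d K x u v) O) (8 + t) o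
  branch false z 2+a≤B z≤B y≡ refl h rewrite y≡ refl =
    relax 3 (step refl _ (step refl _ (step refl _ (column-end 2+a≤B h))))
  branch true z 2+a≤B z≤B y≡ refl h rewrite +-identityʳ (z + z) =
    step refl _ (step refl _ (step refl _ (step refl (_ , z≤n) (step refl (_ , z≤B)
    (step refl _ (column-end 2+a≤B h))))))

  -- For `y = b H + z`, doubling and reducing by `2H - 1` if `b = 1` gives `2z + b`: the leading bit
  -- moves to the end.
  column : ∀ b z {y′ a c d x u v O t o} → z < H → 2 + a ≤ B → bit b + (z + z) ≡ y′ →
    (∀ x u v → HaltsFrom (config 32 (registers y′ (2 + a) c d (H + H) x u v)
                                    (emit b (get inp a) (get inp (suc a)) O)) t o) →
    HaltsFrom (config 16 (registers (bit b * H + z) a (suc c) d (H + H) x u v) O) (14 + t) o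
  column b z z<H 2+a≤B refl h =
    step refl _ (step refl (_ , <⇒≤ 2+a≤B) (step refl _ (step refl (_ , <⇒≤ (y-bound b))
    (step refl (_ , y-bound b) (step refl _ (branch b z 2+a≤B (≤-trans z-bound 4H≤B) (unchanged b) (shifted b) h))))))
    where
    z-bound : suc (z + z) ≤ H + H + (H + H)
    z-bound = ≤-trans (+-mono-≤ z<H (<⇒≤ z<H)) (m≤m+n (H + H) (H + H))
    y : Bool → ℕ
    y b = bit b * H + z
    y<2H : ∀ b → y b < H + H
    y<2H false = ≤-trans z<H (m≤m+n H H)
    y<2H true  rewrite +-identityʳ H = +-monoʳ-< H z<H
    y-bound : ∀ b → suc (y b + y b) ≤ B
    y-bound b = ≤-trans (+-mono-≤ (y<2H b) (<⇒≤ (y<2H b))) 4H≤B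
    unchanged : ∀ b → b ≡ false → y b + y b ≡ z + z
    unchanged false _ = refl
    shifted : ∀ b → suc (y b + y b) ∸ (H + H) ≡ bit b * suc (z + z)
    shifted false = m≤n⇒m∸n≡0 (+-mono-≤ z<H (<⇒≤ z<H))
    shifted true  = trans (cong (_∸ (H + H)) (regroup H z)) (m+n∸m≡n (H + H) _)
      where
      regroup : ∀ H z → suc (H + 0 + z + (H + 0 + z)) ≡ H + H + (suc (z + z) + 0)
      regroup = solve-∀

  -- `β x p` and `ζ x p` stand for the leading bit and the value of the other bits of the rotated
  -- word at column `p` of pass `x`. Their actual form is irrelevant to the execution, which needs
  -- only the four properties assumed below.
  module Passes (β : ℕ → ℕ → Bool) (ζ : ℕ → ℕ → ℕ) where

    state : ℕ → ℕ → ℕ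
    state x p = bit (β x p) * H + ζ x p

    emitted : ℕ → ℕ → List ℕ → List ℕ
    emitted x zero    O = O
    emitted x (suc p) O = emit (β x p) (get inp (2 + p * 2)) (get inp (3 + p * 2)) (emitted x p O)

    emittedPasses : ℕ → List ℕ
    emittedPasses zero    = []
    emittedPasses (suc x) = emitted x L (emittedPasses x)

    budget : ℕ → ℕ
    budget zero    = 0
    budget (suc d) = 3 + (L * 16 + (4 + budget d))

    -- A pass takes 3 steps to start, 4 to end and at most 16 per column; `7 + 16 L ≤ 23 L` as `L`
    -- is positive.
    budget≤ : ∀ d → budget d ≤ d * (L * 23)
    budget≤ zero    = z≤n
    budget≤ (suc d) = begin
      3 + (L * 16 + (4 + budget d))      ≤⟨ +-monoʳ-≤ 3 (+-monoʳ-≤ (L * 16) (+-monoʳ-≤ 4 (budget≤ d))) ⟩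
      3 + (L * 16 + (4 + d * (L * 23)))  ≡⟨ regroup (L * 16) (d * (L * 23)) ⟩
      7 + L * 16 + d * (L * 23)          ≤⟨ +-monoˡ-≤ (d * (L * 23)) (+-monoˡ-≤ (L * 16) (*-monoˡ-≤ 7 (s≤s {0} {l} z≤n))) ⟩
      L * 7 + L * 16 + d * (L * 23)      ≡⟨ cong (_+ d * (L * 23)) (sym (*-distribˡ-+ L 7 16)) ⟩
      suc d * (L * 23)                   ∎
      where
      open ≤-Reasoning
      regroup : ∀ a b → 3 + (a + (4 + b)) ≡ 7 + a + b
      regroup = solve-∀

    module _ (ζ<H : ∀ x p → ζ x p < H)
             (rotates : ∀ x p → bit (β x p) + (ζ x p + ζ x p) ≡ state x (suc p))
             (starts : ∀ x → x < H → state x 0 ≡ x)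
             (returns : ∀ x → x < H → state x L ≡ x) where

      columns : ∀ x c p {d s u v O t o} → L ≡ suc c + p →
        (∀ a s u v → HaltsFrom (config 34 (registers (state x L) a 0 d (H + H) s u v) (emitted x L O)) t o) →
        HaltsFrom (config 16 (registers (state x p) (2 + p * 2) (suc c) d (H + H) s u v) (emitted x p O))
                  (suc c * 16 + t) o
      columns x zero p refl h =
        -- The last column leaves the loop without the `jump` back.
        relax 1 (column (β x p) (ζ x p) (ζ<H x p) 2+2L≤B (rotates x p) λ s u v →
          step refl _ (h _ s u v))
      columns x (suc c) p L≡ h =
        column (β x p) (ζ x p) (ζ<H x p) 2+2p≤B (rotates x p) λ s u v →
          step refl _ (step refl _ (columns x c (suc p) L≡′ h))
        where
        L≡′ : L ≡ suc c + suc p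
        L≡′ = trans L≡ (cong suc (sym (+-suc c p)))
        2+2p≤B : 2 + suc p * 2 ≤ B
        2+2p≤B = ≤-trans (+-monoʳ-≤ 2 (*-monoˡ-≤ 2
          (≤-trans (m≤n+m (suc p) (suc c)) (≤-reflexive (sym L≡′))))) 2+2L≤B

      pass : ∀ x {a c d s u v O t o} → x < H →
        (∀ a s u v → HaltsFrom (config 34 (registers x a 0 d (H + H) s u v) (emitted x L O)) t o) →
        HaltsFrom (config 13 (registers x a c d (H + H) s u v) O) (3 + (L * 16 + t)) o
      pass x {d = d} {O = O} {t = t} {o = o} x<H h =
        step refl (_ , 2≤B) (step refl (_ , z≤n) (step refl (_ , L≤B)
        (subst (λ y → HaltsFrom (config 16 (registers y 2 L d (H + H) _ _ _) O) (L * 16 + t) o) (starts x x<H)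
          (columns x l 0 (cong suc (sym (+-identityʳ l))) λ a s u v →
            subst (λ y → HaltsFrom (config 34 (registers y a 0 d (H + H) s u v) (emitted x L O)) t o)
                  (sym (returns x x<H)) (h a s u v)))))

      x<H⇒1+x≤B : ∀ {x} → x < H → 1 + x ≤ B
      x<H⇒1+x≤B x<H = ≤-trans x<H (≤-trans (≤-trans (m≤m+n H H) (m≤m+n (H + H) (H + H))) 4H≤B)

      passes : ∀ d x {a c s u v} → H ≡ suc d + x →
        HaltsFrom (config 13 (registers x a c (suc d) (H + H) s u v) (emittedPasses x))
                  (budget (suc d)) (emittedPasses H)
      passes zero x H≡ = pass x x<H λ a s u v →
        step refl (_ , x<H⇒1+x≤B x<H) (step refl _ (step refl _ λ X≤ →
          -- Address 38 is just behind the last instruction, so the machine halts.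
          subst (Halts _ _) (cong emittedPasses (sym H≡)) (halt X≤ refl)))
        where
        x<H : x < H
        x<H = ≤-reflexive (sym H≡)
      passes (suc d) x H≡ = pass x x<H λ a s u v →
        step refl (_ , x<H⇒1+x≤B x<H) (step refl _ (step refl _ (step refl _
          (passes d (suc x) H≡′))))
        where
        H≡′ : H ≡ suc d + suc x
        H≡′ = trans H≡ (cong suc (sym (+-suc d x)))
        x<H : x < H
        x<H = subst (x <_) (sym H≡) (s≤s (m≤n+m x (suc d)))

      program-halts : get inp 0 ≡ suc (suc k * 2) → get inp 1 ≡ L →
        Halts initial (7 + (suc k * 6 + suc (budget H))) (emittedPasses H)
      program-halts n≡ L≡ =
        step refl (_ , z≤n) (step refl (_ , ≤-trans (s≤s z≤n) 2≤B) (step refl (_ , 2≤B)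
        (step refl (_ , ≤-trans (s≤s z≤n) 2≤B) (step refl _ (step refl _ (step refl _
        (from-7 n≡ L≡)))))))
        ([] , z≤n)
        where
        q≡H : double^ k 1 ≡ H
        q≡H = trans (double^≡ k 1) (*-identityʳ H)
        2q≤B : double^ k 1 + double^ k 1 ≤ B
        2q≤B = subst (λ q → q + q ≤ B) (sym q≡H) (≤-trans (m≤m+n (H + H) (H + H)) 4H≤B)
        all-passes : ∀ d → H ≡ d →
          HaltsFrom (config 13 (registers 0 0 0 d (H + H) 0 0 0) []) (budget d) (emittedPasses H)
        all-passes zero    H≡0 = contradiction H≡0 (≢-nonZero⁻¹ H {{m^n≢0 2 k}})
        all-passes (suc d) H≡  = passes d 0 (trans H≡ (cong suc (sym (+-identityʳ d))))
        from-13 : let q = double^ k 1 in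
          HaltsFrom (config 13 (registers 0 0 0 q (q + q) 0 0 0) []) (budget H) (emittedPasses H)
        from-13 = subst (λ q → HaltsFrom (config 13 (registers 0 0 0 q (q + q) 0 0 0) []) (budget H) (emittedPasses H))
          (sym q≡H) (all-passes H refl)
        from-7 : ∀ {n L′} → n ≡ suc (suc k * 2) → L′ ≡ L →
          HaltsFrom (config 7 (0 ∷ 0 ∷ 0 ∷ 0 ∷ 1 ∷ L′ ∷ 1 ∷ 2 ∷ n ∸ 1 ∷ 0 ∷ 0 ∷ []) [])
                    (suc k * 6 + suc (budget H)) (emittedPasses H)
        from-7 refl refl = doubling k 2q≤B from-13

-- Rotated words and encoded lists

-- Horner's rule at the last bit: `value` recurses on the leading bit, but a rotation appends at the
-- end.
value-snoc : ∀ k (f : ℕ → Bool) →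
  value (tabulate {n = suc k} (f ∘ toℕ)) ≡ bit (f k) + (value (tabulate {n = k} (f ∘ toℕ)) + value (tabulate {n = k} (f ∘ toℕ)))
value-snoc zero    f = cong (_+ 0) (*-identityʳ (bit (f 0)))
value-snoc (suc k) f = begin
  bit (f 0) * (2 * 2 ^ k) + value (tabulate {n = suc k} (f ∘ suc ∘ toℕ))
    ≡⟨ cong (bit (f 0) * (2 * 2 ^ k) +_) (value-snoc k (f ∘ suc)) ⟩
  bit (f 0) * (2 * 2 ^ k) + (bit (f (suc k)) + (rest + rest))
    ≡⟨ regroup (bit (f 0)) (2 ^ k) (bit (f (suc k))) rest ⟩
  bit (f (suc k)) + ((bit (f 0) * 2 ^ k + rest) + (bit (f 0) * 2 ^ k + rest)) ∎
  where
  open ≡-Reasoning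
  rest : ℕ
  rest = value (tabulate {n = k} (f ∘ suc ∘ toℕ))
  regroup : ∀ b p c r → b * (2 * p) + (c + (r + r)) ≡ c + ((b * p + r) + (b * p + r))
  regroup = solve-∀

get-pairs₁ : ∀ {A : Set} {L} (f g : A → ℕ) (h : Fin L → A) i →
  get (concatMap (λ x → f x ∷ g x ∷ []) (List.tabulate h)) (toℕ i * 2) ≡ f (h i)
get-pairs₁ f g h Fin.zero    = refl
get-pairs₁ f g h (Fin.suc i) = get-pairs₁ f g (h ∘ Fin.suc) i

get-pairs₂ : ∀ {A : Set} {L} (f g : A → ℕ) (h : Fin L → A) i →
  get (concatMap (λ x → f x ∷ g x ∷ []) (List.tabulate h)) (suc (toℕ i * 2)) ≡ g (h i)
get-pairs₂ f g h Fin.zero    = refl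
get-pairs₂ f g h (Fin.suc i) = get-pairs₂ f g (h ∘ Fin.suc) i

reversedPairs : (f g : ℕ → ℕ) → ℕ → List ℕ
reversedPairs f g zero    = []
reversedPairs f g (suc t) = g t ∷ f t ∷ reversedPairs f g t

tabulate-toℕ : ∀ {A : Set} (f : ℕ → A) N → List.tabulate {n = N} (f ∘ toℕ) ≡ applyUpTo f N
tabulate-toℕ f zero    = refl
tabulate-toℕ f (suc N) = cong (f 0 ∷_) (tabulate-toℕ (f ∘ suc) N)

reverse-reversedPairs : ∀ f g N → reverse (reversedPairs f g N) ≡
  concatMap (λ j → f (toℕ j) ∷ g (toℕ j) ∷ []) (allFin N)
reverse-reversedPairs f g N = begin
  reverse (reversedPairs f g N)          ≡⟨ up-to N ⟩
  concatMap h (upTo N)                   ≡⟨ cong (concatMap h) (tabulate-toℕ id N) ⟨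
  concatMap h (List.tabulate {n = N} toℕ) ≡⟨ cong (concatMap h) (map-tabulate {n = N} id toℕ) ⟨
  concatMap h (map toℕ (allFin N))       ≡⟨ concatMap-map h toℕ (allFin N) ⟩
  concatMap (h ∘ toℕ) (allFin N)         ∎
  where
  open ≡-Reasoning
  h : ℕ → List ℕ
  h t = f t ∷ g t ∷ []
  up-to : ∀ N → reverse (reversedPairs f g N) ≡ concatMap h (upTo N)
  up-to zero    = refl
  up-to (suc N) = begin
    reverse (g N ∷ f N ∷ reversedPairs f g N)         ≡⟨ unfold-reverse (g N) (f N ∷ reversedPairs f g N) ⟩
    reverse (f N ∷ reversedPairs f g N) ∷ʳ g N        ≡⟨ cong (_∷ʳ g N) (unfold-reverse (f N) (reversedPairs f g N)) ⟩
    (reverse (reversedPairs f g N) ∷ʳ f N) ∷ʳ g N     ≡⟨ ++-assoc (reverse (reversedPairs f g N)) (f N ∷ []) (g N ∷ []) ⟩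
    reverse (reversedPairs f g N) List.++ h N         ≡⟨ cong (List._++ h N) (up-to N) ⟩
    concatMap h (upTo N) List.++ concatMap h (N ∷ []) ≡⟨ concatMap-++ h (upTo N) (N ∷ []) ⟨
    concatMap h (upTo N ∷ʳ N)                         ≡⟨ cong (concatMap h) (upTo-∷ʳ N) ⟩
    concatMap h (upTo (suc N))                        ∎

encodeCycle-≤ : ∀ {n L B} (C : Fin L → Edge n) → n ≤ B → L ≤ B → All (_≤ B) (encodeCycle C)
encodeCycle-≤ {n} C n≤B L≤B = n≤B ∷ L≤B ∷ All.concat⁺ (All.map⁺ (All.tabulate⁺ λ i →
  endpoint (lo (C i)) ∷ endpoint (hi (C i)) ∷ []))
  where
  endpoint : ∀ (v : Fin n) → toℕ v ≤ _
  endpoint v = ≤-trans (<⇒≤ (toℕ<n v)) n≤B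

-- The program outputs the torus

module Generate (n k l N B : ℕ) (n≡ : n ≡ suc (suc k * 2)) (m∣L : suc k ∣ suc l) (N≡2^k*L : N ≡ 2 ^ k * suc l)
                (C : Fin (suc l) → Edge n)
                (n≤B : n ≤ B) (2+2L≤B : 2 + suc l * 2 ≤ B) (4H≤B : 2 ^ k + 2 ^ k + (2 ^ k + 2 ^ k) ≤ B) where

  open Torus n k (suc l) N m∣L N≡2^k*L C

  inp : List ℕ
  inp = encodeCycle C

  L : ℕ
  L = suc l

  L≤B : L ≤ B
  L≤B = ≤-trans (m≤m*n L 2) (≤-trans (m≤n+m (L * 2) 2) 2+2L≤B)

  open Machine inp B (encodeCycle-≤ C n≤B L≤B) k l 2+2L≤B 4H≤B hiding (L; L≤B)
  open Execution program 11 inp B (encodeCycle-≤ C n≤B L≤B)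

  entry : ℕ → ℕ → Bool
  entry x p = lookup (word x) (p mod m)

  tail-value : ℕ → ℕ → ℕ
  tail-value x p = value (tabulate {n = k} (λ s → entry x (toℕ (Fin.suc s) + p)))

  open Passes entry tail-value

  -- `state x p` unfolds to the value of the word of `x` rotated by `p` places, and `m` places are a
  -- full turn.
  state-cong : ∀ x p q → p % m ≡ q % m → state x p ≡ state x q
  state-cong x p q p≡q = cong value (tabulate-cong {n = m} λ s →
    cong (lookup (word x)) (mod-cong (toℕ s + p) (toℕ s + q) m (begin
      (toℕ s + p) % m                  ≡⟨ %-distribˡ-+ (toℕ s) p m ⟩
      (toℕ s % m + p % m) % m          ≡⟨ cong (λ a → (toℕ s % m + a) % m) p≡q ⟩
      (toℕ s % m + q % m) % m          ≡⟨ %-distribˡ-+ (toℕ s) q m ⟨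
      (toℕ s + q) % m                  ∎)))
    where open ≡-Reasoning

  rotates : ∀ x p → bit (entry x p) + (tail-value x p + tail-value x p) ≡ state x (suc p)
  rotates x p = sym (begin
    state x (suc p)                    ≡⟨ value-snoc k (λ s → entry x (s + suc p)) ⟩
    bit (entry x (k + suc p)) + (tails + tails)
                                       ≡⟨ cong₂ (λ b t → bit b + (t + t)) last-entry tails≡ ⟩
    bit (entry x p) + (tail-value x p + tail-value x p) ∎)
    where
    open ≡-Reasoning
    tails : ℕ
    tails = value (tabulate {n = k} (λ s → entry x (toℕ s + suc p)))
    tails≡ : tails ≡ tail-value x p
    tails≡ = cong value (tabulate-cong {n = k} λ s → cong (entry x) (+-suc (toℕ s) p))
    last-entry : entry x (k + suc p) ≡ entry x p
    last-entry = cong (lookup (word x)) (mod-cong (k + suc p) p m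
      (trans (cong (_% m) (+-suc k p)) (%-remove-+ˡ p n∣n)))

  starts : ∀ x → x < 2 ^ k → state x 0 ≡ x
  starts x x<2^k = begin
    state x 0                  ≡⟨ cong value (tabulate-cong {n = m} λ s → cong (lookup (word x)) (s+0 s)) ⟩
    value (tabulate {n = m} (lookup (word x)))
                               ≡⟨ cong value (tabulate∘lookup (word x)) ⟩
    value (count k x)          ≡⟨ value-count k x x<2^k ⟩
    x                          ∎
    where
    open ≡-Reasoning
    s+0 : ∀ (s : Fin m) → (toℕ s + 0) mod m ≡ s
    s+0 s = toℕ-injective (trans (toℕ-mod (toℕ s + 0) m)
      (trans (cong (_% m) (+-identityʳ (toℕ s))) (m<n⇒m%n≡m (toℕ<n s))))

  -- Divisibility of `L` by `m` makes a pass a whole number of turns, so the rotating register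
  -- doubles as the pass counter.
  returns : ∀ x → x < 2 ^ k → state x L ≡ x
  returns x x<2^k = trans (state-cong x L 0 (%-remove-+ʳ 0 m∣L)) (starts x x<2^k)

  top bottom : ℕ → ℕ
  top    t = toℕ (pick (orientation t) (C (t mod L)))
  bottom t = toℕ (pick (not (orientation t)) (C (t mod L)))

  columnsUpTo : ℕ → List ℕ
  columnsUpTo = reversedPairs top bottom

  emit≡ : ∀ b (e : Edge n) O → emit b (toℕ (lo e)) (toℕ (hi e)) O ≡ toℕ (pick (not b) e) ∷ toℕ (pick b e) ∷ O
  emit≡ false e O = refl
  emit≡ true  e O = refl

  emitted≡ : ∀ x p → p ≤ L → emitted x p (columnsUpTo (x * L)) ≡ columnsUpTo (p + x * L)
  emitted≡ x zero    _   = refl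
  emitted≡ x (suc p) p<L = begin
    emit (entry x p) (get inp (2 + p * 2)) (get inp (3 + p * 2)) (emitted x p (columnsUpTo (x * L)))
      ≡⟨ cong (λ O → emit (entry x p) (get inp (2 + p * 2)) (get inp (3 + p * 2)) O) (emitted≡ x p (<⇒≤ p<L)) ⟩
    emit (entry x p) (get inp (2 + p * 2)) (get inp (3 + p * 2)) O
      ≡⟨ cong₂ (λ l h → emit (entry x p) l h O) lo≡ hi≡ ⟩
    emit (entry x p) (toℕ (lo e)) (toℕ (hi e)) O
      ≡⟨ cong (λ b → emit b (toℕ (lo e)) (toℕ (hi e)) O) entry≡ ⟩
    emit (orientation t) (toℕ (lo e)) (toℕ (hi e)) O
      ≡⟨ emit≡ (orientation t) e O ⟩
    columnsUpTo (suc t) ∎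
    where
    open ≡-Reasoning
    t : ℕ
    t = p + x * L
    O : List ℕ
    O = columnsUpTo t
    e : Edge n
    e = C (t mod L)
    index : toℕ (t mod L) ≡ p
    index = trans (toℕ-mod t L) (trans (%-remove-+ʳ p (n∣m*n x)) (m<n⇒m%n≡m p<L))
    lo≡ : get inp (2 + p * 2) ≡ toℕ (lo e)
    lo≡ = trans (cong (λ p → get inp (2 + p * 2)) (sym index))
      (get-pairs₁ (toℕ ∘ lo ∘ C) (toℕ ∘ hi ∘ C) id (t mod L))
    hi≡ : get inp (3 + p * 2) ≡ toℕ (hi e)
    hi≡ = trans (cong (λ p → get inp (3 + p * 2)) (sym index))
      (get-pairs₂ (toℕ ∘ lo ∘ C) (toℕ ∘ hi ∘ C) id (t mod L))
    entry≡ : entry x p ≡ orientation t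
    entry≡ = sym (cong₂ lookup
      (cong word (trans ([a+x*L]/L p x) (cong (_+ x) (m<n⇒m/n≡0 p<L))))
      (mod-cong t p m (%-remove-+ʳ p (m∣x*L x))))

  emittedPasses≡ : ∀ x → emittedPasses x ≡ columnsUpTo (x * L)
  emittedPasses≡ zero    = refl
  emittedPasses≡ (suc x) = trans (cong (emitted x L) (emittedPasses≡ x)) (emitted≡ x L ≤-refl)

  output≡ : reverse (emittedPasses (2 ^ k)) ≡ encodeColumns torus
  output≡ = begin
    reverse (emittedPasses (2 ^ k))      ≡⟨ cong reverse (emittedPasses≡ (2 ^ k)) ⟩
    reverse (columnsUpTo (2 ^ k * L))    ≡⟨ cong (reverse ∘ columnsUpTo) N≡2^k*L ⟨
    reverse (columnsUpTo N)              ≡⟨ reverse-reversedPairs top bottom N ⟩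
    encodeColumns torus                  ∎
    where open ≡-Reasoning

  -- The setup takes `8 + 6 m ≤ 14 m` steps with `m ≤ L ≤ N`, and the passes take 23 per column;
  -- `37 = 14 + 23`.
  time≤ : 7 + (suc k * 6 + suc (budget (2 ^ k))) ≤ 37 * N
  time≤ = begin
    7 + (m * 6 + suc (budget (2 ^ k)))             ≡⟨ regroup (m * 6) (budget (2 ^ k)) ⟩
    8 + m * 6 + budget (2 ^ k)                     ≤⟨ +-mono-≤ (+-mono-≤ (*-monoˡ-≤ 8 (s≤s {0} {k} z≤n)) ≤-refl) (budget≤ (2 ^ k)) ⟩
    m * 8 + m * 6 + 2 ^ k * (L * 23)               ≡⟨ regroup′ m (2 ^ k) L ⟩
    14 * m + 23 * (2 ^ k * L)                      ≤⟨ +-monoˡ-≤ (23 * (2 ^ k * L)) (*-monoʳ-≤ 14 (≤-trans m≤L (m≤n*m L (2 ^ k)))) ⟩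
    14 * (2 ^ k * L) + 23 * (2 ^ k * L)            ≡⟨ *-distribʳ-+ (2 ^ k * L) 14 23 ⟨
    37 * (2 ^ k * L)                               ≡⟨ cong (37 *_) N≡2^k*L ⟨
    37 * N                                         ∎
    where
    open ≤-Reasoning
    instance _ = m^n≢0 2 k
    regroup : ∀ a b → 7 + (a + suc b) ≡ 8 + a + b
    regroup = solve-∀
    regroup′ : ∀ m h L → m * 8 + m * 6 + h * (L * 23) ≡ 14 * m + 23 * (h * L)
    regroup′ = solve-∀

  generates : ∀ {b} → bits ≤ b → Outputs program inp (encodeColumns torus) (37 * N) b
  generates bits≤b with Halts⇒Run bits≤b (program-halts (λ x p → value<2^k (tabulate {n = k} (λ s → entry x (toℕ (Fin.suc s) + p)))) rotates starts returns n≡ refl)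
  ... | final , steps , steps≤ , run , out≡ = record
    { final = final ; steps = steps ; steps≤ = ≤-trans steps≤ time≤ ; run = run
    ; output = trans (cong reverse out≡) output≡ }

-- Space bound and conclusion

n!≤2^[n*n] : ∀ n → n ! ≤ 2 ^ (n * n)
n!≤2^[n*n] zero    = ≤-refl
n!≤2^[n*n] (suc n) = begin
  suc n * n !                  ≤⟨ *-mono-≤ (n<2^n n) (n!≤2^[n*n] n) ⟩
  2 ^ n * 2 ^ (n * n)          ≡⟨ ^-distribˡ-+-* 2 n (n * n) ⟨
  2 ^ (n + n * n)              ≤⟨ ^-monoʳ-≤ 2 (≤-trans (≤-reflexive (sym (*-suc n n))) (m≤n+m (n * suc n) (suc n))) ⟩
  2 ^ (suc n * suc n)          ∎
  where
  open ≤-Reasoning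
  n<2^n : ∀ n → suc n ≤ 2 ^ n
  n<2^n zero    = ≤-refl
  n<2^n (suc n) = +-mono-≤ (m^n>0 2 n) (≤-trans (n<2^n n) (m≤m+n (2 ^ n) 0))

n≤n! : ∀ n → n ≤ n !
n≤n! zero    = z≤n
n≤n! (suc n) = m≤m*n (suc n) (n !) {{n !≢0}}

cellBound : ℕ → ℕ
cellBound n = 4 + n ! * 2

-- Each of the 11 cells takes at most `1 + (3 + n * n)` bits, which is at most `5 * n ^ 2`.
bits≤ : ∀ n .{{_ : NonZero n}} → 11 * suc ⌈log₂ suc (cellBound n) ⌉ ≤ 55 * n ^ 2
bits≤ n = begin
  11 * suc ⌈log₂ suc (cellBound n) ⌉       ≤⟨ *-monoʳ-≤ 11 (s≤s (⌈log₂⌉-mono-≤ B<)) ⟩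
  11 * suc ⌈log₂ 2 ^ (3 + n * n) ⌉         ≡⟨ cong (λ a → 11 * suc a) (⌈log₂2^n⌉≡n (3 + n * n)) ⟩
  11 * (4 + n * n)                         ≤⟨ *-monoʳ-≤ 11 (+-monoˡ-≤ (n * n) (*-monoʳ-≤ 4 (n*n>0))) ⟩
  11 * (4 * (n * n) + n * n)               ≡⟨ regroup n ⟩
  55 * n ^ 2                               ∎
  where
  open ≤-Reasoning
  n*n>0 : 1 ≤ n * n
  n*n>0 = >-nonZero⁻¹ (n * n) {{m*n≢0 n n}}
  regroup : ∀ n → 11 * (4 * (n * n) + n * n) ≡ 55 * (n * (n * 1))
  regroup = solve-∀
  B< : suc (cellBound n) ≤ 2 ^ (3 + n * n)
  B< = begin
    5 + n ! * 2                  ≤⟨ +-monoˡ-≤ (n ! * 2) (*-monoʳ-≤ 5 (1≤n! n)) ⟩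
    5 * n ! + n ! * 2            ≤⟨ m≤m+n _ (n !) ⟩
    5 * n ! + n ! * 2 + n !      ≡⟨ regroup′ (n !) ⟩
    8 * n !                      ≤⟨ *-monoʳ-≤ 8 (n!≤2^[n*n] n) ⟩
    8 * 2 ^ (n * n)              ≡⟨ ^-distribˡ-+-* 2 3 (n * n) ⟨
    2 ^ (3 + n * n)              ∎
    where
    regroup′ : ∀ f → 5 * f + f * 2 + f ≡ 8 * f
    regroup′ = solve-∀

-- `n`, `L` and `N` are variables with equations, so that the quotients in the theorem can be
-- replaced by products and `L` can be matched as a successor.
generated : ∀ k n → n ≡ suc (suc k * 2) → let m = suc k in
  ∀ L {N} → L ≡ cycleLength m → N ≡ 2 ^ k * cycleLength m → (C : Fin L → Edge n) →
  ((M : Vec (Edge n) m) → IsOrderedMatching M → ∃! _≡_ λ i → cyclicWindow m C i ≡ M) →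
  Σ[ T ∈ Array n N ]
    (((w : Vec (Fin n) (m + m)) → Unique w → ∃! {A = Fin 2 × Fin N} _≡_ λ (i , j) → rowMajor m T i j ≡ w)
    × Outputs program (encodeCycle C) (encodeColumns T) (37 * N) (55 * n ^ 2))
generated k n n≡ zero    L≡ N≡ C universal = contradiction (sym L≡) (≢-nonZero⁻¹ _ {{cycleLength≢0 (suc k)}})
generated k n n≡ (suc l) {N} L≡ N≡ C universal =
  torus , Universal.torus-universal universal , generates (bits≤ n {{subst NonZero (sym n≡) _}})
  where
  m : ℕ
  m = suc k
  open ≤-Reasoning
  instance
    _ = m^n≢0 2 m
    _ = cycleLength≢0 m
  m∣L : m ∣ suc l
  m∣L = subst (m ∣_) (sym L≡) (m∣m*n _)
  n!≡ : n ! ≡ 2 ^ m * cycleLength m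
  n!≡ = trans (cong _! n≡) (factorial≡ m)
  L≤n! : suc l ≤ n !
  L≤n! = begin
    suc l                   ≡⟨ L≡ ⟩
    cycleLength m           ≤⟨ m≤n*m (cycleLength m) (2 ^ m) ⟩
    2 ^ m * cycleLength m   ≡⟨ n!≡ ⟨
    n !                     ∎
  n≤B : n ≤ cellBound n
  n≤B = ≤-trans (n≤n! n) (≤-trans (m≤m*n (n !) 2) (m≤n+m _ 4))
  2+2L≤B : 2 + suc l * 2 ≤ cellBound n
  2+2L≤B = +-mono-≤ {2} (s≤s (s≤s z≤n)) (*-monoˡ-≤ 2 L≤n!)
  4H≤B : 2 ^ k + 2 ^ k + (2 ^ k + 2 ^ k) ≤ cellBound n
  4H≤B = begin
    2 ^ k + 2 ^ k + (2 ^ k + 2 ^ k)    ≡⟨ regroup (2 ^ k) ⟩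
    2 ^ m * 2                          ≤⟨ *-monoˡ-≤ 2 (m≤m*n (2 ^ m) (cycleLength m)) ⟩
    2 ^ m * cycleLength m * 2          ≡⟨ cong (_* 2) n!≡ ⟨
    n ! * 2                            ≤⟨ m≤n+m _ 4 ⟩
    cellBound n                        ∎
    where
    regroup : ∀ h → h + h + (h + h) ≡ 2 * h * 2
    regroup = solve-∀
  N≡2^k*L : N ≡ 2 ^ k * suc l
  N≡2^k*L = trans N≡ (cong (2 ^ k *_) (sym L≡))
  open Torus n k (suc l) N m∣L N≡2^k*L C
  open Generate n k l N (cellBound n) n≡ m∣L N≡2^k*L C n≤B 2+2L≤B 4H≤B

theorem17 : Σ[ P ∈ Program ] Σ[ c ∈ ℕ ] Σ[ a ∈ ℕ ] Σ[ d ∈ ℕ ]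
    ((m n : ℕ) → m ≥ 1 → n ≡ 2 * m + 1 →
    (C : Fin (#matchings n m) → Edge n) → IsUniversalCycle n m C →
    Σ[ T ∈ Array n (n ! / 2) ]
    (IsShorthandUniversalTorus n m T ×
    Outputs P (encodeCycle C) (encodeColumns T) (c * (n ! / 2)) (a * n ^ d)))
theorem17 = program , 37 , 55 , 2 , generate
  where
  2m+1 : ∀ m → 2 * m + 1 ≡ suc (m * 2)
  2m+1 = solve-∀
  generate : (m n : ℕ) → m ≥ 1 → n ≡ 2 * m + 1 →
    (C : Fin (#matchings n m) → Edge n) → IsUniversalCycle n m C →
    Σ[ T ∈ Array n (n ! / 2) ]
    (IsShorthandUniversalTorus n m T ×
    Outputs program (encodeCycle C) (encodeColumns T) (37 * (n ! / 2)) (55 * n ^ 2))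
  generate (suc k) n _ n≡ = generated k n n≡′ _
    (trans (cong (λ n → #matchings n (suc k)) n≡′) (#matchings≡ (suc k)))
    (trans (cong (λ n → n ! / 2) n≡′) (half-factorial≡ k))
    where
    n≡′ : n ≡ suc (suc k * 2)
    n≡′ = trans n≡ (2m+1 (suc k))
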